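{- Let $B$ be a skew-symmetric integer $n\times n$ matrix whose mutation class is infinite. Then the cluster algebra $\mathfrak A(B)$ has exponential growth.
   Context: A seed is a pair $(f,B)$, where $f=\{f_1,\dots,f_n\}$ is a collection of algebraically independent rational functions in $\mathbb Q(x_1,\dots,x_n)$ and $B$ is an integer skew-symmetric $n\times n$ matrix (the exchange matrix). The mutation of $(f,B)$ in direction $k$ is the seed $(f',B')$, where $B'_{ij}=-B_{ij}$ if $i=k$ or $j=k$, $B'_{ij}=B_{ij}+\frac{|B_{ik}|B_{kj}+B_{ik}|B_{kj}|}{2}$ otherwise, and $f'_i=f_i$ for $i\neq k$, $f'_k=\frac{1}{f_k}\left(\prod_{B_{kj}>0}f_j^{B_{kj}}+\prod_{B_{kj}<0}f_j^{ -B_{kj}}\right)$. The mutation class of $B$ is the set of all matrices obtained from $B$ by finite sequences of matrix mutations. The initial seed is $(\{x_1,\dots,x_n\},B)$, and the cluster algebra $\mathfrak A(B)$ is the subalgebra of $\mathbb Q(x_1,\dots,x_n)$ generated by all the elements $f_i$ of all seeds obtained from the initial seed by finite sequences of mutations. The cluster algebra is called mutation-infinite if the mutation class of $B$ is infinite. It has exponential growth if the number of distinct seeds which can be obtained from a fixed initial seed by at most $m$ mutations is bounded from below by an exponentially growing function of $m$ (i.e. by $C r^m$ for some constants $C>0$, $r>1$). -}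

module Defs where

open import Algebra.Bundles using (CommutativeRing; Semiring)
import Algebra.Definitions.RawSemiring as RawSemiringDefs
import Algebra.Properties.Ring as RingProperties
import Algebra.Properties.Semiring.Exp as Exp
import Algebra.Solver.Ring.NaturalCoefficients.Default as Solver
open import Data.Bool.Base using (true; false; _∨_; if_then_else_)
open import Data.Fin.Base using (Fin; zero; suc)
open import Data.Fin.Permutation using (Permutation′; _⟨$⟩ʳ_)
open import Data.Fin.Properties using (_≟_)
import Data.Integer.Base as ℤ
import Data.Integer.DivMod as ℤ
import Data.Integer.Properties as ℤ
import Data.Integer.Solver as ℤSolver
open import Data.Integer.Base using (ℤ; +_; -[1+_])
open import Data.List.Base as List using (List; []; _∷_; foldl; length)
open import Data.List.Relation.Unary.All using (All)
open import Data.List.Relation.Unary.AllPairs using (AllPairs)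
open import Data.List.Relation.Unary.Any using (Any)
import Data.Nat.Base as ℕ
import Data.Nat.DivMod as ℕ
open import Data.Nat.Base using (ℕ; zero; suc)
open import Data.Product.Base using (_×_; _,_; ∃-syntax; Σ-syntax; proj₁; proj₂)
import Data.Rational.Base as ℚ
import Data.Rational.Properties as ℚ
open import Data.Rational.Base using (ℚ; 0ℚ; 1ℚ)
open import Data.Sum.Base using (_⊎_; inj₁; inj₂; [_,_]′)
open import Data.Vec.Functional using (Vector; updateAt)
open import Data.Vec.Functional.Properties using (updateAt-updates; updateAt-minimal)
open import Function.Base using (_∘_)
open import Function.Bundles using (_⇔_)
open import Level using (0ℓ)
open import Relation.Binary.PropositionalEquality as ≡ using (_≡_; _≢_; cong; cong₂)
import Relation.Binary.Reasoning.Setoid as SetoidReasoning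
open import Relation.Binary.Bundles using (Setoid)
open import Relation.Binary.Structures using (IsEquivalence)
open import Relation.Nullary.Decidable.Core using (yes; no; does)
open import Relation.Nullary.Negation using (¬_; contradiction)
open import Relation.Unary using (Pred)

record IntegralDomain : Set₁ where
  field
    commutativeRing : CommutativeRing 0ℓ 0ℓ
  open CommutativeRing commutativeRing public hiding (zero)
  field
    1≉0            : ¬ (1# ≈ 0#)
    noZeroDivisors : ∀ x y → x * y ≈ 0# → x ≈ 0# ⊎ y ≈ 0#

  open RingProperties ring public using (x∙y⁻¹≈ε⇒x≈y; [y-z]x≈yx-zx; x≈y⇒x∙y⁻¹≈ε)

  *-cancelʳ : ∀ x y z → ¬ (z ≈ 0#) → x * z ≈ y * z → x ≈ y
  *-cancelʳ x y z z≉0 xz≈yz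
    with noZeroDivisors (x - y) z (trans ([y-z]x≈yx-zx z x y) (x≈y⇒x∙y⁻¹≈ε xz≈yz))
  ... | inj₁ x-y≈0 = x∙y⁻¹≈ε⇒x≈y x y x-y≈0
  ... | inj₂ z≈0   = contradiction z≈0 z≉0

  *-≉0 : ∀ {x y} → ¬ (x ≈ 0#) → ¬ (y ≈ 0#) → ¬ (x * y ≈ 0#)
  *-≉0 x≉0 y≉0 xy≈0 = [ x≉0 , y≉0 ]′ (noZeroDivisors _ _ xy≈0)

-- A polynomial is its list of coefficients, constant term first; trailing
-- zeros are allowed, so equality compares coefficients.
module Univariate (D : IntegralDomain) where
  open IntegralDomain D
  open Solver commutativeSemiring using (solve; _:+_; _:*_; _:=_; con)

  Poly : Set
  Poly = List Carrier

  coeff : Poly → ℕ → Carrier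
  coeff []      _       = 0#
  coeff (a ∷ p) zero    = a
  coeff (a ∷ p) (suc i) = coeff p i

  infix 4 _≋_
  record _≋_ (p q : Poly) : Set where
    constructor mk≋
    field at : ∀ i → coeff p i ≈ coeff q i
  open _≋_ public

  infixl 6 _+ₚ_
  infixl 7 _*ₚ_ _·_

  _+ₚ_ : Poly → Poly → Poly
  []      +ₚ q       = q
  (a ∷ p) +ₚ []      = a ∷ p
  (a ∷ p) +ₚ (b ∷ q) = (a + b) ∷ (p +ₚ q)

  _·_ : Carrier → Poly → Poly
  a · p = List.map (a *_) p

  _*ₚ_ : Poly → Poly → Poly
  []      *ₚ q = []
  (a ∷ p) *ₚ q = a · q +ₚ (0# ∷ p *ₚ q)

  -ₚ_ : Poly → Poly
  -ₚ p = List.map (-_) p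

  1ₚ : Poly
  1ₚ = 1# ∷ []

  coeff-+ : ∀ p q i → coeff (p +ₚ q) i ≈ coeff p i + coeff q i
  coeff-+ []      q       i       = sym (+-identityˡ _)
  coeff-+ (a ∷ p) []      i       = sym (+-identityʳ _)
  coeff-+ (a ∷ p) (b ∷ q) zero    = refl
  coeff-+ (a ∷ p) (b ∷ q) (suc i) = coeff-+ p q i

  coeff-· : ∀ a p i → coeff (a · p) i ≈ a * coeff p i
  coeff-· a []      i       = sym (zeroʳ a)
  coeff-· a (b ∷ p) zero    = refl
  coeff-· a (b ∷ p) (suc i) = coeff-· a p i

  coeff-neg : ∀ p i → coeff (-ₚ p) i ≈ - coeff p i
  coeff-neg []      i       = sym -0#≈0#
    where open RingProperties ring using (-0#≈0#)
  coeff-neg (b ∷ p) zero    = refl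
  coeff-neg (b ∷ p) (suc i) = coeff-neg p i

  ≋-refl : ∀ {p} → p ≋ p
  ≋-refl = mk≋ λ _ → refl

  ≋-sym : ∀ {p q} → p ≋ q → q ≋ p
  ≋-sym e = mk≋ λ i → sym (at e i)

  ≋-trans : ∀ {p q r} → p ≋ q → q ≋ r → p ≋ r
  ≋-trans e e′ = mk≋ λ i → trans (at e i) (at e′ i)

  ≋-isEquivalence : IsEquivalence _≋_
  ≋-isEquivalence = record { refl = ≋-refl ; sym = ≋-sym ; trans = ≋-trans }

  ≋-setoid : Setoid 0ℓ 0ℓ
  ≋-setoid = record { isEquivalence = ≋-isEquivalence }

  ∷-cong : ∀ {a b p q} → a ≈ b → p ≋ q → (a ∷ p) ≋ (b ∷ q)
  ∷-cong e e′ = mk≋ λ { zero → e ; (suc i) → at e′ i }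

  tail≋ : ∀ {a b p q} → (a ∷ p) ≋ (b ∷ q) → p ≋ q
  tail≋ e = mk≋ λ i → at e (suc i)

  tail≋[] : ∀ {a p} → (a ∷ p) ≋ [] → p ≋ []
  tail≋[] e = mk≋ λ i → at e (suc i)

  0∷[]≋[] : (0# ∷ []) ≋ []
  0∷[]≋[] = mk≋ λ { zero → refl ; (suc i) → refl }

  ∷≋[] : ∀ {a p} → a ≈ 0# → p ≋ [] → (a ∷ p) ≋ []
  ∷≋[] e e′ = mk≋ λ { zero → e ; (suc i) → at e′ i }

  +ₚ-cong : ∀ {p q r s} → p ≋ q → r ≋ s → (p +ₚ r) ≋ (q +ₚ s)
  +ₚ-cong {p} {q} {r} {s} e e′ = mk≋ λ i →
    trans (coeff-+ p r i) (trans (+-cong (at e i) (at e′ i)) (sym (coeff-+ q s i)))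

  +ₚ-assoc : ∀ p q r → ((p +ₚ q) +ₚ r) ≋ (p +ₚ (q +ₚ r))
  +ₚ-assoc p q r = mk≋ λ i → begin
    coeff ((p +ₚ q) +ₚ r) i               ≈⟨ coeff-+ (p +ₚ q) r i ⟩
    coeff (p +ₚ q) i + coeff r i          ≈⟨ +-congʳ (coeff-+ p q i) ⟩
    coeff p i + coeff q i + coeff r i     ≈⟨ +-assoc _ _ _ ⟩
    coeff p i + (coeff q i + coeff r i)   ≈⟨ +-congˡ (coeff-+ q r i) ⟨
    coeff p i + coeff (q +ₚ r) i          ≈⟨ coeff-+ p (q +ₚ r) i ⟨
    coeff (p +ₚ (q +ₚ r)) i               ∎
    where open SetoidReasoning setoid

  +ₚ-comm : ∀ p q → (p +ₚ q) ≋ (q +ₚ p)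
  +ₚ-comm p q = mk≋ λ i →
    trans (coeff-+ p q i) (trans (+-comm _ _) (sym (coeff-+ q p i)))

  +ₚ-identityʳ : ∀ p → (p +ₚ []) ≋ p
  +ₚ-identityʳ p = +ₚ-comm p []

  -ₚ-cong : ∀ {p q} → p ≋ q → (-ₚ p) ≋ (-ₚ q)
  -ₚ-cong {p} {q} e = mk≋ λ i →
    trans (coeff-neg p i) (trans (-‿cong (at e i)) (sym (coeff-neg q i)))

  -ₚ-inverseˡ : ∀ p → ((-ₚ p) +ₚ p) ≋ []
  -ₚ-inverseˡ p = mk≋ λ i →
    trans (coeff-+ (-ₚ p) p i) (trans (+-congʳ (coeff-neg p i)) (-‿inverseˡ _))

  ·-cong : ∀ {a b p q} → a ≈ b → p ≋ q → (a · p) ≋ (b · q)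
  ·-cong {a} {b} {p} {q} e e′ = mk≋ λ i →
    trans (coeff-· a p i) (trans (*-cong e (at e′ i)) (sym (coeff-· b q i)))

  ·-zero : ∀ {a} p → a ≈ 0# → (a · p) ≋ []
  ·-zero {a} p a≈0 = mk≋ λ i →
    trans (coeff-· a p i) (trans (*-congʳ a≈0) (zeroˡ _))

  ·-identity : ∀ p → (1# · p) ≋ p
  ·-identity p = mk≋ λ i → trans (coeff-· 1# p i) (*-identityˡ _)

  ·-assoc : ∀ a b p → ((a * b) · p) ≋ (a · (b · p))
  ·-assoc a b p = mk≋ λ i → trans (coeff-· (a * b) p i) (trans (*-assoc _ _ _)
    (sym (trans (coeff-· a (b · p) i) (*-congˡ (coeff-· b p i)))))

  ·-distribˡ : ∀ a p q → (a · (p +ₚ q)) ≋ (a · p +ₚ a · q)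
  ·-distribˡ a p q = mk≋ λ i → begin
    coeff (a · (p +ₚ q)) i            ≈⟨ coeff-· a (p +ₚ q) i ⟩
    a * coeff (p +ₚ q) i              ≈⟨ *-congˡ (coeff-+ p q i) ⟩
    a * (coeff p i + coeff q i)       ≈⟨ distribˡ _ _ _ ⟩
    a * coeff p i + a * coeff q i     ≈⟨ +-cong (coeff-· a p i) (coeff-· a q i) ⟨
    coeff (a · p) i + coeff (a · q) i ≈⟨ coeff-+ (a · p) (a · q) i ⟨
    coeff (a · p +ₚ a · q) i          ∎
    where open SetoidReasoning setoid

  ·-distribʳ : ∀ a b p → ((a + b) · p) ≋ (a · p +ₚ b · p)
  ·-distribʳ a b p = mk≋ λ i → begin
    coeff ((a + b) · p) i             ≈⟨ coeff-· (a + b) p i ⟩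
    (a + b) * coeff p i               ≈⟨ distribʳ _ _ _ ⟩
    a * coeff p i + b * coeff p i     ≈⟨ +-cong (coeff-· a p i) (coeff-· b p i) ⟨
    coeff (a · p) i + coeff (b · p) i ≈⟨ coeff-+ (a · p) (b · p) i ⟨
    coeff (a · p +ₚ b · p) i          ∎
    where open SetoidReasoning setoid

  shift-+ : ∀ p q → (0# ∷ (p +ₚ q)) ≋ ((0# ∷ p) +ₚ (0# ∷ q))
  shift-+ p q = ∷-cong (sym (+-identityˡ 0#)) ≋-refl

  +ₚ-interchange : ∀ p q r s → ((p +ₚ q) +ₚ (r +ₚ s)) ≋ ((p +ₚ r) +ₚ (q +ₚ s))
  +ₚ-interchange p q r s = mk≋ λ i → begin
    coeff ((p +ₚ q) +ₚ (r +ₚ s)) i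
      ≈⟨ trans (coeff-+ (p +ₚ q) (r +ₚ s) i) (+-cong (coeff-+ p q i) (coeff-+ r s i)) ⟩
    (coeff p i + coeff q i) + (coeff r i + coeff s i)
      ≈⟨ solve 4 (λ a b c d → (a :+ b) :+ (c :+ d) := (a :+ c) :+ (b :+ d)) refl _ _ _ _ ⟩
    (coeff p i + coeff r i) + (coeff q i + coeff s i)
      ≈⟨ trans (coeff-+ (p +ₚ r) (q +ₚ s) i) (+-cong (coeff-+ p r i) (coeff-+ q s i)) ⟨
    coeff ((p +ₚ r) +ₚ (q +ₚ s)) i ∎
    where open SetoidReasoning setoid

  *ₚ-congˡ : ∀ p {q r} → q ≋ r → (p *ₚ q) ≋ (p *ₚ r)
  *ₚ-congˡ []      e = ≋-refl
  *ₚ-congˡ (a ∷ p) e = +ₚ-cong (·-cong refl e) (∷-cong refl (*ₚ-congˡ p e))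

  *ₚ-zeroʳ : ∀ p → (p *ₚ []) ≋ []
  *ₚ-zeroʳ []      = ≋-refl
  *ₚ-zeroʳ (a ∷ p) = ∷≋[] refl (*ₚ-zeroʳ p)

  *ₚ-∷ : ∀ p b q → (p *ₚ (b ∷ q)) ≋ (b · p +ₚ (0# ∷ p *ₚ q))
  *ₚ-∷ []      b q = ≋-sym 0∷[]≋[]
  *ₚ-∷ (a ∷ p) b q = ∷-cong (+-congʳ (*-comm a b)) (begin
    a · q +ₚ (p *ₚ (b ∷ q))              ≈⟨ +ₚ-cong ≋-refl (*ₚ-∷ p b q) ⟩
    a · q +ₚ (b · p +ₚ (0# ∷ p *ₚ q))    ≈⟨ +ₚ-assoc (a · q) (b · p) _ ⟨
    a · q +ₚ b · p +ₚ (0# ∷ p *ₚ q)      ≈⟨ +ₚ-cong (+ₚ-comm (a · q) (b · p)) ≋-refl ⟩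
    b · p +ₚ a · q +ₚ (0# ∷ p *ₚ q)      ≈⟨ +ₚ-assoc (b · p) (a · q) _ ⟩
    b · p +ₚ (a · q +ₚ (0# ∷ p *ₚ q))    ∎)
    where open SetoidReasoning ≋-setoid

  *ₚ-comm : ∀ p q → (p *ₚ q) ≋ (q *ₚ p)
  *ₚ-comm []      q = ≋-sym (*ₚ-zeroʳ q)
  *ₚ-comm (a ∷ p) q =
    ≋-trans (+ₚ-cong ≋-refl (∷-cong refl (*ₚ-comm p q))) (≋-sym (*ₚ-∷ q a p))

  *ₚ-cong : ∀ {p q r s} → p ≋ q → r ≋ s → (p *ₚ r) ≋ (q *ₚ s)
  *ₚ-cong {p} {q} {r} {s} e e′ =
    ≋-trans (*ₚ-congˡ p e′)
      (≋-trans (*ₚ-comm p s) (≋-trans (*ₚ-congˡ s e) (*ₚ-comm s q)))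

  *ₚ-distribʳ : ∀ r p q → ((p +ₚ q) *ₚ r) ≋ (p *ₚ r +ₚ q *ₚ r)
  *ₚ-distribʳ r []      q       = ≋-refl
  *ₚ-distribʳ r (a ∷ p) []      = ≋-sym (+ₚ-identityʳ _)
  *ₚ-distribʳ r (a ∷ p) (b ∷ q) = begin
    (a + b) · r +ₚ (0# ∷ (p +ₚ q) *ₚ r)
      ≈⟨ +ₚ-cong (·-distribʳ a b r)
                 (≋-trans (∷-cong refl (*ₚ-distribʳ r p q)) (shift-+ (p *ₚ r) (q *ₚ r))) ⟩
    (a · r +ₚ b · r) +ₚ ((0# ∷ p *ₚ r) +ₚ (0# ∷ q *ₚ r))
      ≈⟨ +ₚ-interchange (a · r) (b · r) _ _ ⟩
    (a · r +ₚ (0# ∷ p *ₚ r)) +ₚ (b · r +ₚ (0# ∷ q *ₚ r)) ∎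
    where open SetoidReasoning ≋-setoid

  *ₚ-distribˡ : ∀ r p q → (r *ₚ (p +ₚ q)) ≋ (r *ₚ p +ₚ r *ₚ q)
  *ₚ-distribˡ r p q = ≋-trans (*ₚ-comm r (p +ₚ q)) (≋-trans (*ₚ-distribʳ r p q)
    (+ₚ-cong (*ₚ-comm p r) (*ₚ-comm q r)))

  shift-* : ∀ p q → ((0# ∷ p) *ₚ q) ≋ (0# ∷ p *ₚ q)
  shift-* p q = +ₚ-cong (·-zero q refl) ≋-refl

  ·-*ₚ : ∀ a p q → ((a · p) *ₚ q) ≋ (a · (p *ₚ q))
  ·-*ₚ a []      q = ≋-refl
  ·-*ₚ a (b ∷ p) q = begin
    (a * b) · q +ₚ (0# ∷ (a · p) *ₚ q)
      ≈⟨ +ₚ-cong (·-assoc a b q) (∷-cong (sym (zeroʳ a)) (·-*ₚ a p q)) ⟩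
    a · (b · q) +ₚ a · (0# ∷ p *ₚ q)
      ≈⟨ ·-distribˡ a (b · q) (0# ∷ p *ₚ q) ⟨
    a · (b · q +ₚ (0# ∷ p *ₚ q)) ∎
    where open SetoidReasoning ≋-setoid

  *ₚ-assoc : ∀ p q r → ((p *ₚ q) *ₚ r) ≋ (p *ₚ (q *ₚ r))
  *ₚ-assoc []      q r = ≋-refl
  *ₚ-assoc (a ∷ p) q r = begin
    (a · q +ₚ (0# ∷ p *ₚ q)) *ₚ r
      ≈⟨ *ₚ-distribʳ r (a · q) (0# ∷ p *ₚ q) ⟩
    (a · q) *ₚ r +ₚ (0# ∷ p *ₚ q) *ₚ r
      ≈⟨ +ₚ-cong (·-*ₚ a q r) (≋-trans (shift-* (p *ₚ q) r) (∷-cong refl (*ₚ-assoc p q r))) ⟩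
    a · (q *ₚ r) +ₚ (0# ∷ p *ₚ (q *ₚ r)) ∎
    where open SetoidReasoning ≋-setoid

  *ₚ-identityˡ : ∀ p → (1ₚ *ₚ p) ≋ p
  *ₚ-identityˡ p =
    ≋-trans (+ₚ-cong (·-identity p) 0∷[]≋[]) (+ₚ-identityʳ p)

  polyRing : CommutativeRing 0ℓ 0ℓ
  polyRing = record
    { Carrier = Poly ; _≈_ = _≋_ ; _+_ = _+ₚ_ ; _*_ = _*ₚ_ ; -_ = -ₚ_ ; 0# = [] ; 1# = 1ₚ
    ; isCommutativeRing = record
      { isRing = record
        { +-isAbelianGroup = record
          { isGroup = record
            { isMonoid = record
              { isSemigroup = record
                { isMagma = record { isEquivalence = ≋-isEquivalence ; ∙-cong = +ₚ-cong }
                ; assoc = +ₚ-assoc }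
              ; identity = (λ _ → ≋-refl) , +ₚ-identityʳ }
            ; inverse = -ₚ-inverseˡ
                      , (λ p → ≋-trans (+ₚ-comm p (-ₚ p)) (-ₚ-inverseˡ p))
            ; ⁻¹-cong = -ₚ-cong }
          ; comm = +ₚ-comm }
        ; *-cong = *ₚ-cong
        ; *-assoc = *ₚ-assoc
        ; *-identity = *ₚ-identityˡ , (λ p → ≋-trans (*ₚ-comm p 1ₚ) (*ₚ-identityˡ p))
        ; distrib = *ₚ-distribˡ , *ₚ-distribʳ
        }
      ; *-comm = *ₚ-comm
      }
    }

  polyNoZeroDivisors : ∀ p q → (p *ₚ q) ≋ [] → p ≋ [] ⊎ q ≋ []
  polyNoZeroDivisors []      q       e = inj₁ ≋-refl
  polyNoZeroDivisors (a ∷ p) []      e = inj₂ ≋-refl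
  polyNoZeroDivisors (a ∷ p) (b ∷ q) e =
    [ (λ a≈0 → [ (λ p≋[] → inj₁ (∷≋[] a≈0 p≋[])) , inj₂ ]′
        (polyNoZeroDivisors p (b ∷ q)
          (≋-trans (≋-sym (+ₚ-cong (·-zero q a≈0) ≋-refl)) (tail≋[] e))))
    , (λ b≈0 → [ inj₁ , (λ q≋[] → inj₂ (∷≋[] b≈0 q≋[])) ]′
        (polyNoZeroDivisors (a ∷ p) q (tail≋[]
          (≋-trans (≋-sym (≋-trans (*ₚ-∷ (a ∷ p) b q)
                                   (+ₚ-cong (·-zero (a ∷ p) b≈0) ≋-refl))) e))))
    ]′ (noZeroDivisors a b (trans (sym (+-identityʳ (a * b))) (at e 0)))

  polyDomain : IntegralDomain
  polyDomain = record
    { commutativeRing = polyRing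
    ; 1≉0 = λ e → 1≉0 (at e 0)
    ; noZeroDivisors = polyNoZeroDivisors
    }

module FractionField (D : IntegralDomain) where
  open IntegralDomain D
  open Solver commutativeSemiring using (solve; _:+_; _:*_; _:=_; con)

  infix 8 _/_[_]
  record Fraction : Set where
    no-eta-equality
    constructor _/_[_]
    field
      num   : Carrier
      den   : Carrier
      den≉0 : ¬ (den ≈ 0#)
  open Fraction public

  infix 4 _≃_
  record _≃_ (x y : Fraction) : Set where
    constructor mk≃
    field cross : num x * den y ≈ num y * den x
  open _≃_ public

  infixl 6 _+ᶠ_
  infixl 7 _*ᶠ_

  _+ᶠ_ _*ᶠ_ : Fraction → Fraction → Fraction
  x +ᶠ y = (num x * den y + num y * den x) / (den x * den y) [ *-≉0 (den≉0 x) (den≉0 y) ]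
  x *ᶠ y = (num x * num y) / (den x * den y) [ *-≉0 (den≉0 x) (den≉0 y) ]

  -ᶠ_ : Fraction → Fraction
  -ᶠ x = (- num x) / den x [ den≉0 x ]

  embed : Carrier → Fraction
  embed a = a / 1# [ 1≉0 ]

  0ᶠ 1ᶠ : Fraction
  0ᶠ = embed 0#
  1ᶠ = embed 1#

  num≈0⇒≃0 : ∀ {x} → num x ≈ 0# → x ≃ 0ᶠ
  num≈0⇒≃0 e = mk≃ (trans (*-congʳ e) (trans (zeroˡ _) (sym (zeroˡ _))))

  ≃0⇒num≈0 : ∀ {x} → x ≃ 0ᶠ → num x ≈ 0#
  ≃0⇒num≈0 e = trans (sym (*-identityʳ _)) (trans (cross e) (zeroˡ _))

  inv : (x : Fraction) → ¬ (x ≃ 0ᶠ) → Fraction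
  inv x x≄0 = den x / num x [ (λ e → x≄0 (num≈0⇒≃0 e)) ]

  ≃-refl : ∀ {x} → x ≃ x
  ≃-refl = mk≃ refl

  ≃-sym : ∀ {x y} → x ≃ y → y ≃ x
  ≃-sym e = mk≃ (sym (cross e))

  ≃-trans : ∀ {x y z} → x ≃ y → y ≃ z → x ≃ z
  ≃-trans {x} {y} {z} e e′ = mk≃ (*-cancelʳ _ _ (den y) (den≉0 y) (begin
    num x * den z * den y   ≈⟨ swap _ _ _ ⟩
    num x * den y * den z   ≈⟨ *-congʳ (cross e) ⟩
    num y * den x * den z   ≈⟨ swap _ _ _ ⟩
    num y * den z * den x   ≈⟨ *-congʳ (cross e′) ⟩
    num z * den y * den x   ≈⟨ swap _ _ _ ⟩
    num z * den x * den y   ∎))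
    where
    open SetoidReasoning setoid
    swap : ∀ a b c → a * b * c ≈ a * c * b
    swap = solve 3 (λ a b c → a :* b :* c := a :* c :* b) refl

  ≃-isEquivalence : IsEquivalence _≃_
  ≃-isEquivalence = record { refl = ≃-refl ; sym = ≃-sym ; trans = ≃-trans }

  *ᶠ-cong : ∀ {x y u v} → x ≃ y → u ≃ v → (x *ᶠ u) ≃ (y *ᶠ v)
  *ᶠ-cong e e′ = mk≃ (trans (mid _ _ _ _) (trans (*-cong (cross e) (cross e′)) (mid _ _ _ _)))
    where
    mid : ∀ a b c d → (a * b) * (c * d) ≈ (a * c) * (b * d)
    mid = solve 4 (λ a b c d → (a :* b) :* (c :* d) := (a :* c) :* (b :* d)) refl

  +ᶠ-cong : ∀ {x y u v} → x ≃ y → u ≃ v → (x +ᶠ u) ≃ (y +ᶠ v)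
  +ᶠ-cong {x} {y} {u} {v} e e′ = mk≃ (begin
    (num x * den u + num u * den x) * (den y * den v)
      ≈⟨ solve 6 (λ a b c d p q → (a :* d :+ c :* b) :* (p :* q)
                   := (a :* p) :* (d :* q) :+ (c :* q) :* (b :* p)) refl
           (num x) (den x) (num u) (den u) (den y) (den v) ⟩
    (num x * den y) * (den u * den v) + (num u * den v) * (den x * den y)
      ≈⟨ +-cong (*-congʳ (cross e)) (*-congʳ (cross e′)) ⟩
    (num y * den x) * (den u * den v) + (num v * den u) * (den x * den y)
      ≈⟨ solve 6 (λ a b c d p q → (a :* p) :* (q :* d) :+ (c :* q) :* (p :* b)
                   := (a :* d :+ c :* b) :* (p :* q)) refl
           (num y) (den y) (num v) (den v) (den x) (den u) ⟩
    (num y * den v + num v * den y) * (den x * den u) ∎)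
    where open SetoidReasoning setoid

  +ᶠ-assoc : ∀ x y z → ((x +ᶠ y) +ᶠ z) ≃ (x +ᶠ (y +ᶠ z))
  +ᶠ-assoc x y z = mk≃ (solve 6 (λ a b c d e f →
    ((a :* d :+ c :* b) :* f :+ e :* (b :* d)) :* (b :* (d :* f))
    := (a :* (d :* f) :+ (c :* f :+ e :* d) :* b) :* ((b :* d) :* f)) refl
    (num x) (den x) (num y) (den y) (num z) (den z))

  +ᶠ-comm : ∀ x y → (x +ᶠ y) ≃ (y +ᶠ x)
  +ᶠ-comm x y = mk≃ (solve 4 (λ a b c d →
    (a :* d :+ c :* b) :* (d :* b) := (c :* b :+ a :* d) :* (b :* d)) refl
    (num x) (den x) (num y) (den y))

  +ᶠ-identityˡ : ∀ x → (0ᶠ +ᶠ x) ≃ x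
  +ᶠ-identityˡ x = mk≃ (solve 2 (λ a b →
    (con 0 :* b :+ a :* con 1) :* b := a :* (con 1 :* b)) refl (num x) (den x))

  -ᶠ-cong : ∀ {x y} → x ≃ y → (-ᶠ x) ≃ (-ᶠ y)
  -ᶠ-cong e = mk≃ (trans (sym (-‿distribˡ-* _ _)) (trans (-‿cong (cross e)) (-‿distribˡ-* _ _)))
    where open RingProperties ring using (-‿distribˡ-*)

  -ᶠ-inverseˡ : ∀ x → ((-ᶠ x) +ᶠ x) ≃ 0ᶠ
  -ᶠ-inverseˡ x = num≈0⇒≃0
    (trans (sym (distribʳ _ _ _)) (trans (*-congʳ (-‿inverseˡ _)) (zeroˡ _)))

  *ᶠ-assoc : ∀ x y z → ((x *ᶠ y) *ᶠ z) ≃ (x *ᶠ (y *ᶠ z))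
  *ᶠ-assoc x y z = mk≃ (*-cong (*-assoc _ _ _) (sym (*-assoc _ _ _)))

  *ᶠ-comm : ∀ x y → (x *ᶠ y) ≃ (y *ᶠ x)
  *ᶠ-comm x y = mk≃ (*-cong (*-comm _ _) (*-comm _ _))

  *ᶠ-identityˡ : ∀ x → (1ᶠ *ᶠ x) ≃ x
  *ᶠ-identityˡ x = mk≃ (solve 2 (λ a b → (con 1 :* a) :* b := a :* (con 1 :* b)) refl (num x) (den x))

  *ᶠ-distribʳ : ∀ z x y → ((x +ᶠ y) *ᶠ z) ≃ (x *ᶠ z +ᶠ y *ᶠ z)
  *ᶠ-distribʳ z x y = mk≃ (solve 6 (λ a b c d e f →
    ((a :* d :+ c :* b) :* e) :* ((b :* f) :* (d :* f))
    := ((a :* e) :* (d :* f) :+ (c :* e) :* (b :* f)) :* ((b :* d) :* f)) refl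
    (num x) (den x) (num y) (den y) (num z) (den z))

  fractionRing : CommutativeRing 0ℓ 0ℓ
  fractionRing = record
    { Carrier = Fraction ; _≈_ = _≃_ ; _+_ = _+ᶠ_ ; _*_ = _*ᶠ_ ; -_ = -ᶠ_ ; 0# = 0ᶠ ; 1# = 1ᶠ
    ; isCommutativeRing = record
      { isRing = record
        { +-isAbelianGroup = record
          { isGroup = record
            { isMonoid = record
              { isSemigroup = record
                { isMagma = record { isEquivalence = ≃-isEquivalence ; ∙-cong = +ᶠ-cong }
                ; assoc = +ᶠ-assoc }
              ; identity = +ᶠ-identityˡ
                         , (λ x → ≃-trans (+ᶠ-comm x 0ᶠ) (+ᶠ-identityˡ x)) }
            ; inverse = -ᶠ-inverseˡ
                      , (λ x → ≃-trans (+ᶠ-comm x (-ᶠ x)) (-ᶠ-inverseˡ x))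
            ; ⁻¹-cong = -ᶠ-cong }
          ; comm = +ᶠ-comm }
        ; *-cong = *ᶠ-cong
        ; *-assoc = *ᶠ-assoc
        ; *-identity = *ᶠ-identityˡ , (λ x → ≃-trans (*ᶠ-comm x 1ᶠ) (*ᶠ-identityˡ x))
        ; distrib = (λ z x y → ≃-trans (*ᶠ-comm z (x +ᶠ y)) (≃-trans (*ᶠ-distribʳ z x y)
                                 (+ᶠ-cong (*ᶠ-comm x z) (*ᶠ-comm y z))))
                  , *ᶠ-distribʳ
        }
      ; *-comm = *ᶠ-comm
      }
    }

  inv-inverseʳ : ∀ x (x≄0 : ¬ (x ≃ 0ᶠ)) → (x *ᶠ inv x x≄0) ≃ 1ᶠ
  inv-inverseʳ x x≄0 = mk≃ (solve 2 (λ a b → (a :* b) :* con 1 := con 1 :* (b :* a)) refl (num x) (den x))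

  inv-cancel : ∀ x (x≄0 : ¬ (x ≃ 0ᶠ)) y → (x *ᶠ (inv x x≄0 *ᶠ y)) ≃ y
  inv-cancel x x≄0 y = ≃-trans (≃-sym (*ᶠ-assoc x (inv x x≄0) y))
    (≃-trans (*ᶠ-cong {x *ᶠ inv x x≄0} {1ᶠ} {y} {y} (inv-inverseʳ x x≄0) ≃-refl) (*ᶠ-identityˡ y))

  fractionDomain : IntegralDomain
  fractionDomain = record
    { commutativeRing = fractionRing
    ; 1≉0 = λ e → 1≉0 (≃0⇒num≈0 e)
    ; noZeroDivisors = λ x y e →
        [ inj₁ ∘ num≈0⇒≃0 , inj₂ ∘ num≈0⇒≃0 ]′ (noZeroDivisors (num x) (num y) (≃0⇒num≈0 e))
    }

ℚ-domain : IntegralDomain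
ℚ-domain = record
  { commutativeRing = ℚ.+-*-commutativeRing
  ; 1≉0 = λ ()
  ; noZeroDivisors = noZeroDivisors
  }
  where
  noZeroDivisors : ∀ p q → p ℚ.* q ≡ 0ℚ → p ≡ 0ℚ ⊎ q ≡ 0ℚ
  noZeroDivisors p q pq≡0 with p ℚ.≟ 0ℚ
  ... | yes p≡0 = inj₁ p≡0
  ... | no  p≢0 = inj₂ (begin
      q                        ≡⟨ ℚ.*-identityˡ q ⟨
      1ℚ ℚ.* q                 ≡⟨ cong (ℚ._* q) (ℚ.*-inverseˡ p) ⟨
      (ℚ.1/ p) ℚ.* p ℚ.* q     ≡⟨ ℚ.*-assoc (ℚ.1/ p) p q ⟩
      (ℚ.1/ p) ℚ.* (p ℚ.* q)   ≡⟨ cong ((ℚ.1/ p) ℚ.*_) pq≡0 ⟩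
      (ℚ.1/ p) ℚ.* 0ℚ          ≡⟨ ℚ.*-zeroʳ (ℚ.1/ p) ⟩
      0ℚ                       ∎)
    where
    open ≡.≡-Reasoning
    instance _ = ℚ.≢-nonZero p≢0

-- ℚ[x₁,…,xₙ], built by adjoining one variable at a time; index zero is the
-- variable adjoined last.
ℚ[x_] : ℕ → IntegralDomain
ℚ[x zero ]  = ℚ-domain
ℚ[x suc n ] = Univariate.polyDomain ℚ[x n ]

module Polynomial (n : ℕ) = IntegralDomain ℚ[x n ]

Polynomial : ℕ → Set
Polynomial n = Polynomial.Carrier n

const : ∀ n → ℚ → Polynomial n
const zero    c = c
const (suc n) c = const n c ∷ []

X : ∀ n → Fin n → Polynomial n
X (suc n) zero    = Polynomial.0# n ∷ Polynomial.1# n ∷ []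
X (suc n) (suc i) = X n i ∷ []

ℚ⟨x_⟩ : ℕ → IntegralDomain
ℚ⟨x n ⟩ = FractionField.fractionDomain ℚ[x n ]

module RationalFunction (n : ℕ) where
  open FractionField ℚ[x n ] public using (Fraction; embed; inv; inv-cancel)
  open IntegralDomain ℚ⟨x n ⟩ public

RationalFunction : ℕ → Set
RationalFunction n = RationalFunction.Carrier n

constᶠ : ∀ n → ℚ → RationalFunction n
constᶠ n c = RationalFunction.embed n (const n c)

x : ∀ n → Vector (RationalFunction n) n
x n i = RationalFunction.embed n (X n i)

module Evaluation (S : CommutativeRing 0ℓ 0ℓ) where
  open CommutativeRing S hiding (zero)

  horner : ∀ {A : Set} → (A → Carrier) → Carrier → List A → Carrier
  horner h s []      = 0#
  horner h s (a ∷ p) = h a + s * horner h s p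

  eval : (ℚ → Carrier) → ∀ n → Polynomial n → Vector Carrier n → Carrier
  eval ι zero    c z = ι c
  eval ι (suc n) p z = horner (λ c → eval ι n c (z ∘ suc)) (z zero) p

evalᶠ : ∀ n → Polynomial n → Vector (RationalFunction n) n → RationalFunction n
evalᶠ n = Evaluation.eval (RationalFunction.commutativeRing n) (constᶠ n) n

AlgebraicallyIndependent : ∀ n → Vector (RationalFunction n) n → Set
AlgebraicallyIndependent n f =
  ∀ (p : Polynomial n) →
  RationalFunction._≈_ n (evalᶠ n p f) (RationalFunction.0# n) →
  Polynomial._≈_ n p (Polynomial.0# n)

Matrix : ℕ → Set
Matrix n = Vector (Vector ℤ n) n

infix 4 _≐_
_≐_ : ∀ {n} → Matrix n → Matrix n → Set
B ≐ C = ∀ i j → B i j ≡ C i j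

SkewSymmetric : ∀ {n} → Matrix n → Set
SkewSymmetric B = ∀ i j → B i j ≡ ℤ.- B j i

μ : ∀ {n} → Fin n → Matrix n → Matrix n
μ k B i j =
  if does (i ≟ k) ∨ does (j ≟ k)
  then ℤ.- B i j
  else B i j ℤ.+ (+ ℤ.∣ B i k ∣ ℤ.* B k j ℤ.+ B i k ℤ.* + ℤ.∣ B k j ∣) ℤ./ + 2

[_]₊ : ℤ → ℕ
[ + m ]₊      = m
[ -[1+ _ ] ]₊ = 0

module Exchange (S : CommutativeRing 0ℓ 0ℓ) where
  open CommutativeRing S hiding (zero)
  open RawSemiringDefs (Semiring.rawSemiring semiring) using (_^_; product)

  -- ∏ f_j^{b_j} over b_j > 0, plus ∏ f_j^{-b_j} over b_j < 0.
  binomial : ∀ {n} → Vector Carrier n → Vector ℤ n → Carrier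
  binomial f b = product (λ j → f j ^ [ b j ]₊) + product (λ j → f j ^ [ ℤ.- b j ]₊)

module _ {n : ℕ} where
  open RationalFunction n
  open Exchange commutativeRing

  mutateFunctions : ∀ (k : Fin n) (B : Matrix n) (f : Vector Carrier n) → ¬ (f k ≈ 0#) →
                    Vector Carrier n
  mutateFunctions k B f fₖ≉0 = updateAt f k (λ fₖ → inv (f k) fₖ≉0 * binomial f (B k))

half : ℤ → ℤ → ℤ
half a b = (+ ℤ.∣ a ∣ ℤ.* b ℤ.+ a ℤ.* + ℤ.∣ b ∣) ℤ./ + 2

c*2/2≡c : ∀ c → (c ℤ.* + 2) ℤ./ + 2 ≡ c
c*2/2≡c (+ m) = ≡.trans (ℤ.div-pos-is-/ℕ (+ m ℤ.* + 2) 2)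
  (≡.trans (cong (ℤ._/ℕ 2) (≡.sym (ℤ.pos-* m 2))) (cong +_ (ℕ.m*n/n≡m m 2)))
c*2/2≡c -[1+ m ] = ≡.trans (ℤ.div-pos-is-/ℕ (-[1+ m ] ℤ.* + 2) 2) lemma
  where
  lemma : -[1+ suc (m ℕ.* 2) ] ℤ./ℕ 2 ≡ -[1+ m ]
  lemma with suc m ℕ.* 2 ℕ.% 2 | ℕ.m*n%n≡0 (suc m) 2
  ... | .0 | ≡.refl = cong (λ q → ℤ.- (+ q)) (ℕ.m*n/n≡m (suc m) 2)

even : ∀ a b → ∃[ c ] + ℤ.∣ a ∣ ℤ.* b ℤ.+ a ℤ.* + ℤ.∣ b ∣ ≡ c ℤ.* + 2
even (+ m) (+ n) = + m ℤ.* + n ,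
  solve 2 (λ a b → a :* b :+ a :* b := a :* b :* con (+ 2)) ≡.refl (+ m) (+ n)
  where open ℤSolver.+-*-Solver
even (+ m) -[1+ n ] = + 0 ,
  solve 2 (λ a b → a :* (:- b) :+ a :* b := con (+ 0) :* con (+ 2)) ≡.refl (+ m) (+ suc n)
  where open ℤSolver.+-*-Solver
even -[1+ m ] (+ n) = + 0 ,
  solve 2 (λ a b → a :* b :+ (:- a) :* b := con (+ 0) :* con (+ 2)) ≡.refl (+ suc m) (+ n)
  where open ℤSolver.+-*-Solver
even -[1+ m ] -[1+ n ] = ℤ.- (+ suc m ℤ.* + suc n) ,
  solve 2 (λ a b → a :* (:- b) :+ (:- a) :* b := (:- (a :* b)) :* con (+ 2)) ≡.refl (+ suc m) (+ suc n)
  where open ℤSolver.+-*-Solver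

half-skew : ∀ a b → half a b ≡ ℤ.- half (ℤ.- b) (ℤ.- a)
half-skew a b = begin
  half a b                          ≡⟨ cong (ℤ._/ + 2) a,b-even ⟩
  (c ℤ.* + 2) ℤ./ + 2               ≡⟨ c*2/2≡c c ⟩
  c                                 ≡⟨ ℤ.neg-involutive c ⟨
  ℤ.- (ℤ.- c)                       ≡⟨ cong ℤ.-_ (c*2/2≡c (ℤ.- c)) ⟨
  ℤ.- (((ℤ.- c) ℤ.* + 2) ℤ./ + 2)   ≡⟨ cong (λ z → ℤ.- (z ℤ./ + 2)) flipped ⟨
  ℤ.- half (ℤ.- b) (ℤ.- a)          ∎
  where
  open ≡.≡-Reasoning
  c = proj₁ (even a b)
  a,b-even = proj₂ (even a b)
  flipped : + ℤ.∣ ℤ.- b ∣ ℤ.* (ℤ.- a) ℤ.+ (ℤ.- b) ℤ.* + ℤ.∣ ℤ.- a ∣ ≡ (ℤ.- c) ℤ.* + 2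
  flipped = begin
    + ℤ.∣ ℤ.- b ∣ ℤ.* (ℤ.- a) ℤ.+ (ℤ.- b) ℤ.* + ℤ.∣ ℤ.- a ∣
      ≡⟨ cong₂ (λ u v → + u ℤ.* (ℤ.- a) ℤ.+ (ℤ.- b) ℤ.* + v) (ℤ.∣-i∣≡∣i∣ b) (ℤ.∣-i∣≡∣i∣ a) ⟩
    + ℤ.∣ b ∣ ℤ.* (ℤ.- a) ℤ.+ (ℤ.- b) ℤ.* + ℤ.∣ a ∣
      ≡⟨ solve 4 (λ a b u v → v :* (:- a) :+ (:- b) :* u := :- (u :* b :+ a :* v)) ≡.refl
           a b (+ ℤ.∣ a ∣) (+ ℤ.∣ b ∣) ⟩
    ℤ.- (+ ℤ.∣ a ∣ ℤ.* b ℤ.+ a ℤ.* + ℤ.∣ b ∣)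
      ≡⟨ cong ℤ.-_ a,b-even ⟩
    ℤ.- (c ℤ.* + 2)
      ≡⟨ ℤ.neg-distribˡ-* c (+ 2) ⟩
    (ℤ.- c) ℤ.* + 2 ∎
    where open ℤSolver.+-*-Solver

μ-skew : ∀ {n} k (B : Matrix n) → SkewSymmetric B → SkewSymmetric (μ k B)
μ-skew k B skew i j with does (i ≟ k) | does (j ≟ k)
... | true  | true  = cong ℤ.-_ (skew i j)
... | true  | false = cong ℤ.-_ (skew i j)
... | false | true  = cong ℤ.-_ (skew i j)
... | false | false = begin
  B i j ℤ.+ half (B i k) (B k j)
    ≡⟨ cong₂ ℤ._+_ (skew i j) (half-skew (B i k) (B k j)) ⟩
  ℤ.- B j i ℤ.+ ℤ.- half (ℤ.- B k j) (ℤ.- B i k)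
    ≡⟨ cong₂ (λ u v → ℤ.- B j i ℤ.+ ℤ.- half u v) (≡.sym (skew j k)) (≡.sym (skew k i)) ⟩
  ℤ.- B j i ℤ.+ ℤ.- half (B j k) (B k i)
    ≡⟨ ℤ.neg-distrib-+ (B j i) (half (B j k) (B k i)) ⟨
  ℤ.- (B j i ℤ.+ half (B j k) (B k i)) ∎
  where open ≡.≡-Reasoning

skew-diagonal : ∀ {n} {B : Matrix n} → SkewSymmetric B → ∀ k → B k k ≡ + 0
skew-diagonal {B = B} skew k = z≡-z⇒z≡0 (B k k) (skew k k)
  where
  z≡-z⇒z≡0 : ∀ z → z ≡ ℤ.- z → z ≡ + 0
  z≡-z⇒z≡0 (+ zero)  _  = ≡.refl
  z≡-z⇒z≡0 (+ suc m) ()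
  z≡-z⇒z≡0 -[1+ m ]  ()

record IsHom (A B : CommutativeRing 0ℓ 0ℓ)
             (h : CommutativeRing.Carrier A → CommutativeRing.Carrier B) : Set where
  private
    module A = CommutativeRing A
    module B = CommutativeRing B
  field
    cong-homo : ∀ {a b} → a A.≈ b → h a B.≈ h b
    +-homo    : ∀ a b → h (a A.+ b) B.≈ h a B.+ h b
    *-homo    : ∀ a b → h (a A.* b) B.≈ h a B.* h b
    0-homo    : h A.0# B.≈ B.0#
    1-homo    : h A.1# B.≈ B.1#

  private
    module EA = Exchange A
    module EB = Exchange B
    module RA = RawSemiringDefs (Semiring.rawSemiring A.semiring)
    module RB = RawSemiringDefs (Semiring.rawSemiring B.semiring)

  ^-homo : ∀ a m → h (a RA.^ m) B.≈ h a RB.^ m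
  ^-homo a zero    = 1-homo
  ^-homo a (suc m) = B.trans (*-homo _ _) (B.*-congˡ (^-homo a m))

  product-homo : ∀ {n} (v : Vector A.Carrier n) → h (RA.product v) B.≈ RB.product (h ∘ v)
  product-homo {zero}  v = 1-homo
  product-homo {suc n} v = B.trans (*-homo _ _) (B.*-congˡ (product-homo (v ∘ suc)))

  product-^-homo : ∀ {n} (v : Vector A.Carrier n) (e : Vector ℕ n) →
                   h (RA.product (λ j → v j RA.^ e j)) B.≈ RB.product (λ j → h (v j) RB.^ e j)
  product-^-homo {zero}  v e = 1-homo
  product-^-homo {suc n} v e =
    B.trans (*-homo _ _) (B.*-cong (^-homo (v zero) (e zero)) (product-^-homo (v ∘ suc) (e ∘ suc)))

  binomial-homo : ∀ {n} (v : Vector A.Carrier n) b → h (EA.binomial v b) B.≈ EB.binomial (h ∘ v) b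
  binomial-homo v b = B.trans (+-homo _ _) (B.+-cong (product-^-homo v (λ j → [ b j ]₊)) (product-^-homo v (λ j → [ ℤ.- b j ]₊)))

idHom : ∀ A → IsHom A A (λ a → a)
idHom A = record
  { cong-homo = λ e → e ; +-homo = λ _ _ → refl ; *-homo = λ _ _ → refl
  ; 0-homo = refl ; 1-homo = refl }
  where open CommutativeRing A hiding (zero)

constHom : ∀ n → IsHom ℚ.+-*-commutativeRing (Polynomial.commutativeRing n) (const n)
constHom zero    = idHom _
constHom (suc n) = record
  { cong-homo = λ e → ∷-cong (cong-homo e) ≋-refl
  ; +-homo    = λ a b → ∷-cong (+-homo a b) ≋-refl
  ; *-homo    = λ a b → ∷-cong (trans (*-homo a b) (sym (+-identityʳ _))) ≋-refl
  ; 0-homo    = ∷≋[] 0-homo ≋-refl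
  ; 1-homo    = ∷-cong 1-homo ≋-refl
  }
  where
  open IsHom (constHom n)
  open Univariate ℚ[x n ]
  open Polynomial n

embedHom : ∀ D → IsHom (IntegralDomain.commutativeRing D) (FractionField.fractionRing D)
                       (FractionField.embed D)
embedHom D = record
  { cong-homo = λ e → mk≃ (*-congʳ e)
  ; +-homo    = λ a b → mk≃ (solve 2 (λ a b → (a :+ b) :* (con 1 :* con 1)
                                := (a :* con 1 :+ b :* con 1) :* con 1) refl a b)
  ; *-homo    = λ a b → mk≃ (solve 2 (λ a b → (a :* b) :* (con 1 :* con 1)
                                := (a :* b) :* con 1) refl a b)
  ; 0-homo    = mk≃ refl
  ; 1-homo    = mk≃ refl
  }
  where
  open IntegralDomain D
  open FractionField D
  open Solver commutativeSemiring using (solve; _:+_; _:*_; _:=_; con)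

_∘ʰ_ : ∀ {A B C g h} → IsHom B C g → IsHom A B h → IsHom A C (g ∘ h)
_∘ʰ_ {C = C} G H = record
  { cong-homo = λ e → G.cong-homo (H.cong-homo e)
  ; +-homo    = λ a b → trans (G.cong-homo (H.+-homo a b)) (G.+-homo _ _)
  ; *-homo    = λ a b → trans (G.cong-homo (H.*-homo a b)) (G.*-homo _ _)
  ; 0-homo    = trans (G.cong-homo H.0-homo) G.0-homo
  ; 1-homo    = trans (G.cong-homo H.1-homo) G.1-homo
  }
  where
  module G = IsHom G
  module H = IsHom H
  open CommutativeRing C hiding (zero)

constᶠHom : ∀ n → IsHom ℚ.+-*-commutativeRing (RationalFunction.commutativeRing n) (constᶠ n)
constᶠHom n = embedHom ℚ[x n ] ∘ʰ constHom n

module HornerHom (D : IntegralDomain) (S : CommutativeRing 0ℓ 0ℓ)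
                 {h : IntegralDomain.Carrier D → CommutativeRing.Carrier S}
                 (H : IsHom (IntegralDomain.commutativeRing D) S h)
                 (s : CommutativeRing.Carrier S) where
  private module D = IntegralDomain D
  open Univariate D
  open IsHom H
  open CommutativeRing S hiding (zero)
  open SetoidReasoning setoid
  open Solver commutativeSemiring using (solve; _:+_; _:*_; _:=_; con)

  e : Poly → Carrier
  e = Evaluation.horner S h s

  e-[] : ∀ p → p ≋ [] → e p ≈ 0#
  e-[] []      _  = refl
  e-[] (a ∷ p) eq = begin
    h a + s * e p  ≈⟨ +-cong (trans (cong-homo (at eq 0)) 0-homo) (*-congˡ (e-[] p (tail≋[] eq))) ⟩
    0# + s * 0#    ≈⟨ trans (+-identityˡ _) (zeroʳ s) ⟩
    0#             ∎

  e-cong : ∀ p q → p ≋ q → e p ≈ e q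
  e-cong []      q       eq = sym (e-[] q (≋-sym eq))
  e-cong (a ∷ p) []      eq = e-[] (a ∷ p) eq
  e-cong (a ∷ p) (b ∷ q) eq =
    +-cong (cong-homo (at eq 0)) (*-congˡ (e-cong p q (tail≋ eq)))

  e-+ : ∀ p q → e (p +ₚ q) ≈ e p + e q
  e-+ []      q       = sym (+-identityˡ _)
  e-+ (a ∷ p) []      = sym (+-identityʳ _)
  e-+ (a ∷ p) (b ∷ q) = begin
    h (a D.+ b) + s * e (p +ₚ q)      ≈⟨ +-cong (+-homo a b) (*-congˡ (e-+ p q)) ⟩
    h a + h b + s * (e p + e q)       ≈⟨ solve 5 (λ a b s p q →
                                           a :+ b :+ s :* (p :+ q) := a :+ s :* p :+ (b :+ s :* q))
                                           refl (h a) (h b) s (e p) (e q) ⟩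
    h a + s * e p + (h b + s * e q)   ∎

  e-· : ∀ a p → e (a · p) ≈ h a * e p
  e-· a []      = sym (zeroʳ _)
  e-· a (b ∷ p) = begin
    h (a D.* b) + s * e (a · p)    ≈⟨ +-cong (*-homo a b) (*-congˡ (e-· a p)) ⟩
    h a * h b + s * (h a * e p)    ≈⟨ solve 4 (λ a b s p →
                                        a :* b :+ s :* (a :* p) := a :* (b :+ s :* p))
                                        refl (h a) (h b) s (e p) ⟩
    h a * (h b + s * e p)          ∎

  e-* : ∀ p q → e (p *ₚ q) ≈ e p * e q
  e-* []      q = sym (zeroˡ _)
  e-* (a ∷ p) q = begin
    e (a · q +ₚ (D.0# ∷ p *ₚ q))           ≈⟨ e-+ (a · q) (D.0# ∷ p *ₚ q) ⟩
    e (a · q) + (h D.0# + s * e (p *ₚ q))  ≈⟨ +-cong (e-· a q) (+-cong 0-homo (*-congˡ (e-* p q))) ⟩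
    h a * e q + (0# + s * (e p * e q))     ≈⟨ solve 4 (λ a q s p →
                                                a :* q :+ (con 0 :+ s :* (p :* q))
                                                := (a :+ s :* p) :* q)
                                                refl (h a) (e q) s (e p) ⟩
    (h a + s * e p) * e q                  ∎

  hornerHom : IsHom polyRing S e
  hornerHom = record
    { cong-homo = e-cong _ _ ; +-homo = e-+ ; *-homo = e-* ; 0-homo = refl
    ; 1-homo = trans (+-cong 1-homo (zeroʳ s)) (+-identityʳ _) }

module EvalHom (S : CommutativeRing 0ℓ 0ℓ) {ι : ℚ → CommutativeRing.Carrier S}
               (I : IsHom ℚ.+-*-commutativeRing S ι) where
  open CommutativeRing S hiding (zero)
  open Evaluation S

  evalHom : ∀ n z → IsHom (Polynomial.commutativeRing n) S (λ p → eval ι n p z)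
  evalHom zero    z = I
  evalHom (suc n) z = HornerHom.hornerHom ℚ[x n ] S (evalHom n (z ∘ suc)) (z zero)

  eval-const : ∀ n c z → eval ι n (const n c) z ≈ ι c
  eval-const zero    c z = refl
  eval-const (suc n) c z =
    trans (+-cong (eval-const n c (z ∘ suc)) (zeroʳ _)) (+-identityʳ _)

  eval-X : ∀ n i z → eval ι n (X n i) z ≈ z i
  eval-X (suc n) zero    z = begin
    eval ι n (Polynomial.0# n) z′ + z zero * (eval ι n (Polynomial.1# n) z′ + z zero * 0#)
      ≈⟨ +-cong 0-homo (*-congˡ (+-congʳ 1-homo)) ⟩
    0# + z zero * (1# + z zero * 0#)
      ≈⟨ solve 1 (λ z → con 0 :+ z :* (con 1 :+ z :* con 0) := z) refl (z zero) ⟩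
    z zero ∎
    where
    z′ = z ∘ suc
    open IsHom (evalHom n z′)
    open SetoidReasoning setoid
    open Solver commutativeSemiring using (solve; _:+_; _:*_; _:=_; con)
  eval-X (suc n) (suc i) z = trans (+-cong (eval-X n i (z ∘ suc)) (zeroʳ _)) (+-identityʳ _)

polyInduction :
  ∀ n (T : Polynomial n → Set) → let open Polynomial n in
  (∀ {p q} → p ≈ q → T p → T q) →
  (∀ c → T (const n c)) → (∀ i → T (X n i)) →
  (∀ {p q} → T p → T q → T (p + q)) → (∀ {p q} → T p → T q → T (p * q)) →
  ∀ p → T p
polyInduction zero    T resp tc tX t+ t* c = tc c
polyInduction (suc n) T resp tc tX t+ t* = go
  where
  open Univariate ℚ[x n ]
  open Polynomial n
  coefficient : ∀ a → T (a ∷ [])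
  coefficient = polyInduction n (λ a → T (a ∷ []))
    (λ e → resp (∷-cong e ≋-refl)) tc (λ i → tX (suc i)) t+
    (λ ta tb → resp (∷-cong (+-identityʳ _) ≋-refl) (t* ta tb))
  go : ∀ p → T p
  go []      = resp (IsHom.0-homo (constHom (suc n))) (tc 0ℚ)
  go (a ∷ p) = resp a+Xp≋a∷p (t+ (coefficient a) (t* (tX zero) (go p)))
    where
    a+Xp≋a∷p : ((a ∷ []) +ₚ (X (suc n) zero *ₚ p)) ≋ (a ∷ p)
    a+Xp≋a∷p = ≋-trans
      (+ₚ-cong (≋-refl {a ∷ []}) (≋-trans (shift-* 1ₚ p) (∷-cong refl (*ₚ-identityˡ p))))
      (∷-cong (+-identityʳ a) ≋-refl)

module Unique (S : CommutativeRing 0ℓ 0ℓ) (n : ℕ)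
              {h : Polynomial n → CommutativeRing.Carrier S}
              (H : IsHom (Polynomial.commutativeRing n) S h) where
  open CommutativeRing S hiding (zero)
  ι∘const = H ∘ʰ constHom n
  open EvalHom S ι∘const
  open Evaluation S
  module H = IsHom H
  module E = IsHom (evalHom n (h ∘ X n))

  eval-unique : ∀ p → eval (h ∘ const n) n p (h ∘ X n) ≈ h p
  eval-unique = polyInduction n _
    (λ e t → trans (sym (E.cong-homo e)) (trans t (H.cong-homo e)))
    (λ c → eval-const n c (h ∘ X n))
    (λ i → eval-X n i (h ∘ X n))
    (λ tp tq → trans (E.+-homo _ _) (trans (+-cong tp tq) (sym (H.+-homo _ _))))
    (λ tp tq → trans (E.*-homo _ _) (trans (*-cong tp tq) (sym (H.*-homo _ _))))

x-independent : ∀ n → AlgebraicallyIndependent n (x n)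
x-independent n p p[x]≈0 =
  FractionField.≃0⇒num≈0 ℚ[x n ] (trans (sym (eval-unique p)) p[x]≈0)
  where
  open RationalFunction n
  open Unique commutativeRing n (embedHom ℚ[x n ])

module Ones (n : ℕ) where
  open EvalHom ℚ.+-*-commutativeRing (idHom ℚ.+-*-commutativeRing)
  open Exchange ℚ.+-*-commutativeRing
  open RawSemiringDefs (Semiring.rawSemiring (CommutativeRing.semiring ℚ.+-*-commutativeRing))
    using (_^_; product)
  open IsHom (evalHom n (λ _ → 1ℚ))

  1^ : ∀ m → 1ℚ ^ m ≡ 1ℚ
  1^ zero    = ≡.refl
  1^ (suc m) = ≡.trans (ℚ.*-identityˡ _) (1^ m)

  product-1^ : ∀ {m} (v : Vector ℚ m) (e : Vector ℕ m) → (∀ j → v j ≡ 1ℚ) →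
               product (λ j → v j ^ e j) ≡ 1ℚ
  product-1^ {zero}  v e eq = ≡.refl
  product-1^ {suc m} v e eq = ≡.trans
    (cong₂ ℚ._*_ (≡.trans (cong (_^ e zero) (eq zero)) (1^ (e zero)))
                 (product-1^ (v ∘ suc) (e ∘ suc) (eq ∘ suc)))
    (ℚ.*-identityˡ 1ℚ)

  X≉0 : ∀ i → ¬ Polynomial._≈_ n (X n i) (Polynomial.0# n)
  X≉0 i eq with () ← ≡.trans (≡.sym (eval-X n i _)) (≡.trans (cong-homo eq) 0-homo)

  binomial≉0 : ∀ b → ¬ Polynomial._≈_ n
    (Exchange.binomial (Polynomial.commutativeRing n) (X n) b) (Polynomial.0# n)
  binomial≉0 b eq
    with () ← ≡.trans (≡.sym (≡.trans (binomial-homo (X n) b)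
                (cong₂ ℚ._+_ (product-1^ (λ j → Evaluation.eval ℚ.+-*-commutativeRing (λ c → c) n (X n j) _) (λ j → [ b j ]₊) (λ j → eval-X n j _))
                              (product-1^ (λ j → Evaluation.eval ℚ.+-*-commutativeRing (λ c → c) n (X n j) _) (λ j → [ ℤ.- b j ]₊) (λ j → eval-X n j _)))))
              (≡.trans (cong-homo eq) 0-homo)

-- Let g be obtained from f by an exchange in direction k.  Every p(g) becomes a
-- polynomial q in f after multiplication by a power of f_k, and since f is in turn
-- the exchange of g, the same q also satisfies q(g) = g_k^d p(f).
module MutationIndependence
  (S : IntegralDomain) {ι : ℚ → IntegralDomain.Carrier S}
  (I : IsHom ℚ.+-*-commutativeRing (IntegralDomain.commutativeRing S) ι)
  {n : ℕ} (k : Fin n) (b : Vector ℤ n) (bₖ≡0 : b k ≡ + 0) where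
  open IntegralDomain S
  open Exchange commutativeRing
  open EvalHom commutativeRing I
  open SetoidReasoning setoid
  open Exp semiring using (_^_; ^-congˡ; ^-homo-*)
  open RawSemiringDefs (Semiring.rawSemiring semiring) using (product)
  open Solver commutativeSemiring using (solve; _:+_; _:*_; _:=_; con)
  private module P = Polynomial n
  private module PE = Exp P.semiring

  ev : P.Carrier → Vector Carrier n → Carrier
  ev = Evaluation.eval commutativeRing ι n

  Independent : Vector Carrier n → Set
  Independent f = ∀ p → ev p f ≈ 0# → p P.≈ P.0#

  record Exchanged (z w : Vector Carrier n) : Set where
    field
      at-k  : z k * w k ≈ binomial z b
      off-k : ∀ {j} → j ≢ k → z j ≈ w j
  open Exchanged

  ^≉0 : ∀ {a} → ¬ (a ≈ 0#) → ∀ m → ¬ (a ^ m ≈ 0#)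
  ^≉0 a≉0 zero    = 1≉0
  ^≉0 a≉0 (suc m) = *-≉0 a≉0 (^≉0 a≉0 m)

  product-cong : ∀ {m} {u v : Vector Carrier m} → (∀ j → u j ≈ v j) → product u ≈ product v
  product-cong {zero}  eq = refl
  product-cong {suc m} eq = *-cong (eq zero) (product-cong (eq ∘ suc))

  binomial-cong : ∀ {u v : Vector Carrier n} → (∀ {j} → j ≢ k → u j ≈ v j) →
                  binomial u b ≈ binomial v b
  binomial-cong {u} {v} eq = +-cong (product-cong (factor (λ z → [ z ]₊) ≡.refl))
                                    (product-cong (factor (λ z → [ ℤ.- z ]₊) ≡.refl))
    where
    factor : (e : ℤ → ℕ) → e (+ 0) ≡ 0 → ∀ j → u j ^ e (b j) ≈ v j ^ e (b j)
    factor e e0≡0 j with j ≟ k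
    ... | no j≢k = ^-congˡ (e (b j)) (eq j≢k)
    ... | yes ≡.refl rewrite bₖ≡0 | e0≡0 = refl

  flip : ∀ {z w} → Exchanged z w → Exchanged w z
  flip r = record
    { at-k  = trans (*-comm _ _) (trans (at-k r) (binomial-cong (off-k r)))
    ; off-k = λ j≢k → sym (off-k r j≢k) }

  binomialₚ : P.Carrier
  binomialₚ = Exchange.binomial P.commutativeRing (X n) b

  eval-binomial : ∀ z → ev binomialₚ z ≈ binomial z b
  eval-binomial z = trans (IsHom.binomial-homo (evalHom n z) (X n) b)
                          (binomial-cong (λ {j} _ → eval-X n j z))

  Clears : P.Carrier → Set
  Clears p = ∃[ d ] Σ[ q ∈ P.Carrier ]
    (∀ {z w} → Exchanged z w → ev q z ≈ z k ^ d * ev p w)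

  clears : ∀ p → Clears p
  clears = polyInduction n Clears resp const-clears X-clears +-clears *-clears
    where
    module E (z : Vector Carrier n) = IsHom (evalHom n z)

    resp : ∀ {p p′} → p P.≈ p′ → Clears p → Clears p′
    resp p≈p′ (d , q , eq) = d , q , λ {_} {w} r → trans (eq r) (*-congˡ (E.cong-homo w p≈p′))

    const-clears : ∀ c → Clears (const n c)
    const-clears c = 0 , const n c , λ {z} {w} _ →
      trans (eval-const n c z) (sym (trans (*-identityˡ _) (eval-const n c w)))

    X-clears : ∀ i → Clears (X n i)
    X-clears i with i ≟ k
    ... | no i≢k = 0 , X n i , λ {z} {w} r →
      trans (eval-X n i z) (trans (off-k r i≢k) (sym (trans (*-identityˡ _) (eval-X n i w))))
    ... | yes ≡.refl = 1 , binomialₚ , λ {z} {w} r →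
      trans (eval-binomial z) (trans (sym (at-k r))
        (*-cong (sym (*-identityʳ _)) (sym (eval-X n k w))))

    eval-^ : ∀ z d → ev (X n k PE.^ d) z ≈ z k ^ d
    eval-^ z d = trans (E.^-homo z (X n k) d) (^-congˡ d (eval-X n k z))

    +-clears : ∀ {p p′} → Clears p → Clears p′ → Clears (p P.+ p′)
    +-clears {p} {p′} (d , q , eq) (d′ , q′ , eq′) =
      d ℕ.+ d′ , ((X n k PE.^ d′) P.* q) P.+ ((X n k PE.^ d) P.* q′) , λ {z} {w} r → begin
        ev (((X n k PE.^ d′) P.* q) P.+ ((X n k PE.^ d) P.* q′)) z
          ≈⟨ trans (E.+-homo z _ _) (+-cong (E.*-homo z _ _) (E.*-homo z _ _)) ⟩
        ev (X n k PE.^ d′) z * ev q z + ev (X n k PE.^ d) z * ev q′ z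
          ≈⟨ +-cong (*-cong (eval-^ z d′) (eq r)) (*-cong (eval-^ z d) (eq′ r)) ⟩
        z k ^ d′ * (z k ^ d * ev p w) + z k ^ d * (z k ^ d′ * ev p′ w)
          ≈⟨ solve 4 (λ a b p q → b :* (a :* p) :+ a :* (b :* q) := (a :* b) :* (p :+ q)) refl
               (z k ^ d) (z k ^ d′) (ev p w) (ev p′ w) ⟩
        (z k ^ d * z k ^ d′) * (ev p w + ev p′ w)
          ≈⟨ *-cong (^-homo-* (z k) d d′) (E.+-homo w p p′) ⟨
        z k ^ (d ℕ.+ d′) * ev (p P.+ p′) w ∎

    *-clears : ∀ {p p′} → Clears p → Clears p′ → Clears (p P.* p′)
    *-clears {p} {p′} (d , q , eq) (d′ , q′ , eq′) =
      d ℕ.+ d′ , q P.* q′ , λ {z} {w} r → begin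
        ev (q P.* q′) z
          ≈⟨ E.*-homo z q q′ ⟩
        ev q z * ev q′ z
          ≈⟨ *-cong (eq r) (eq′ r) ⟩
        (z k ^ d * ev p w) * (z k ^ d′ * ev p′ w)
          ≈⟨ solve 4 (λ a b p q → (a :* p) :* (b :* q) := (a :* b) :* (p :* q)) refl
               (z k ^ d) (z k ^ d′) (ev p w) (ev p′ w) ⟩
        (z k ^ d * z k ^ d′) * (ev p w * ev p′ w)
          ≈⟨ *-cong (^-homo-* (z k) d d′) (E.*-homo w p p′) ⟨
        z k ^ (d ℕ.+ d′) * ev (p P.* p′) w ∎

  independent : ∀ {f g} → Exchanged f g → Independent f → Independent g
  independent {f} {g} r indep p p[g]≈0 with clears p
  ... | d , q , eq = indep p p[f]≈0
    where
    q≈0 : q P.≈ P.0#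
    q≈0 = indep q (trans (eq r) (trans (*-congˡ p[g]≈0) (zeroʳ _)))
    gₖ≉0 : ¬ (g k ≈ 0#)
    gₖ≉0 gₖ≈0 = Ones.binomial≉0 n b (indep binomialₚ (trans (eval-binomial f)
      (trans (sym (at-k r)) (trans (*-congˡ gₖ≈0) (zeroʳ _)))))
    p[f]≈0 : ev p f ≈ 0#
    p[f]≈0 = [ (λ e → contradiction e (^≉0 gₖ≉0 d)) , (λ e → e) ]′
      (noZeroDivisors _ _ (trans (sym (eq (flip r)))
        (trans (IsHom.cong-homo (evalHom n g) q≈0) (IsHom.0-homo (evalHom n g)))))

  independent⇒≉0 : ∀ {f} → Independent f → ¬ (f k ≈ 0#)
  independent⇒≉0 {f} indep fₖ≈0 = Ones.X≉0 n k (indep (X n k) (trans (eval-X n k f) fₖ≈0))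

mutation-exchanges : ∀ {n} (k : Fin n) (B : Matrix n) (skew : SkewSymmetric B) f fₖ≉0 →
  MutationIndependence.Exchanged ℚ⟨x n ⟩ (constᶠHom n) k (B k) (skew-diagonal skew k) f (mutateFunctions k B f fₖ≉0)
mutation-exchanges {n} k B skew f fₖ≉0 = record
  { at-k  = begin
      f k * mutateFunctions k B f fₖ≉0 k           ≡⟨ cong (f k *_) (updateAt-updates k f) ⟩
      f k * (inv (f k) fₖ≉0 * binomial f (B k))    ≈⟨ inv-cancel (f k) fₖ≉0 (binomial f (B k)) ⟩
      binomial f (B k)                             ∎
  ; off-k = λ {j} j≢k → reflexive (≡.sym (updateAt-minimal j k f j≢k))
  }
  where
  open RationalFunction n
  open Exchange commutativeRing
  open SetoidReasoning setoid

record Seed (n : ℕ) : Set where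
  field
    f           : Vector (RationalFunction n) n
    B           : Matrix n
    independent : AlgebraicallyIndependent n f
    skew        : SkewSymmetric B

mutate : ∀ {n} → Fin n → Seed n → Seed n
mutate {n} k S = record
  { f           = mutateFunctions k B f fₖ≉0
  ; B           = μ k B
  ; independent = M.independent (mutation-exchanges k B skew f fₖ≉0) independent
  ; skew        = μ-skew k B skew
  }
  where
  open Seed S
  module M = MutationIndependence ℚ⟨x n ⟩ (constᶠHom n) k (B k) (skew-diagonal skew k)
  fₖ≉0 = M.independent⇒≉0 independent

-- Mutations are applied from the left end of the list.
mutations : ∀ {n} → List (Fin n) → Seed n → Seed n
mutations ks S = foldl (λ T k → mutate k T) S ks

matrixMutations : ∀ {n} → List (Fin n) → Matrix n → Matrix n
matrixMutations ks B = foldl (λ C k → μ k C) B ks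

-- The cluster f is an unordered set, so seeds that differ by a simultaneous
-- renumbering of the functions and of the rows and columns of B are the same.
infix 4 _≈ˢ_
_≈ˢ_ : ∀ {n} → Seed n → Seed n → Set
_≈ˢ_ {n} S T = Σ[ σ ∈ Permutation′ n ]
  (∀ i → RationalFunction._≈_ n (Seed.f S (σ ⟨$⟩ʳ i)) (Seed.f T i)) ×
  (∀ i j → Seed.B S (σ ⟨$⟩ʳ i) (σ ⟨$⟩ʳ j) ≡ Seed.B T i j)

MutationClass : ∀ {n} → Matrix n → Pred (Matrix n) 0ℓ
MutationClass B C = ∃[ ks ] C ≐ matrixMutations ks B

FiniteSet : ∀ {n} → Pred (Matrix n) 0ℓ → Set
FiniteSet P = ∃[ Cs ] (∀ C → P C ⇔ Any (C ≐_) Cs)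

MutationInfinite : ∀ {n} → Matrix n → Set
MutationInfinite B = ¬ FiniteSet (MutationClass B)

initialSeed : ∀ {n} (B : Matrix n) → SkewSymmetric B → Seed n
initialSeed {n} B skew = record { f = x n ; B = B ; independent = x-independent n ; skew = skew }

-- A cluster algebra carries the seed it is generated from.
record ClusterAlgebra (n : ℕ) : Set where
  constructor generatedFrom
  field
    seed : Seed n

  open RationalFunction n

  data Element : Pred Carrier 0ℓ where
    variable-∈ : ∀ ks i → Element (Seed.f (mutations ks seed) i)
    const-∈    : ∀ c → Element (constᶠ n c)
    +-∈        : ∀ {g h} → Element g → Element h → Element (g + h)
    *-∈        : ∀ {g h} → Element g → Element h → Element (g * h)
    resp-∈     : ∀ {g h} → g ≈ h → Element g → Element h

𝔄 : ∀ {n} (B : Matrix n) → SkewSymmetric B → ClusterAlgebra n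
𝔄 B skew = generatedFrom (initialSeed B skew)

WithinMutations : ∀ {n} → ℕ → Seed n → Pred (Seed n) 0ℓ
WithinMutations m S T = ∃[ ks ] length ks ℕ.≤ m × T ≡ mutations ks S

ℚ-pow : ℚ → ℕ → ℚ
ℚ-pow = RawSemiringDefs._^_ (Semiring.rawSemiring (CommutativeRing.semiring ℚ.+-*-commutativeRing))

-- For every m there are at least C·r^m seeds, pairwise distinct, within m
-- mutations of the initial one.  Rational C and r lose nothing: real constants
-- can be decreased to rational ones.
ExponentialGrowth : ∀ {n} → ClusterAlgebra n → Set
ExponentialGrowth {n} 𝒜 =
  ∃[ C ] ∃[ r ] 0ℚ ℚ.< C × 1ℚ ℚ.< r ×
  (∀ m → Σ[ Ss ∈ List (Seed n) ]
    All (WithinMutations m (ClusterAlgebra.seed 𝒜)) Ss ×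
    AllPairs (λ S T → ¬ (S ≈ˢ T)) Ss ×
    C ℚ.* ℚ-pow r m ℚ.≤ (+ length Ss) ℚ./ 1)

{-# OPTIONS --safe #-}
module Submission where

open import Defs
open import Algebra.Bundles using (CommutativeRing; Semiring)
import Algebra.Definitions.RawSemiring as RawSemiringDefs
import Algebra.Properties.CommutativeMonoid.Sum as Sum
import Algebra.Properties.CommutativeSemiring.Exp as CommutativeExp
import Algebra.Properties.Semiring.Exp as Exp
import Algebra.Solver.Ring.NaturalCoefficients.Default as Solver
open import Data.Bool.Base using (true; false; _∨_; if_then_else_)
open import Data.Fin.Base as Fin
  using (Fin; zero; suc; toℕ; fromℕ<; combine; quotient; remainder; funToFin)
open import Data.Fin.Permutation using (Permutation′; _⟨$⟩ʳ_; _⟨$⟩ˡ_; inverseˡ; inverseʳ)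
open import Data.Fin.Properties as Fin
  using (_≟_; any?; pigeonhole; combine-injective; combine-remQuot; finToFun-funToFin;
         toℕ<n; toℕ-injective)
import Data.Integer.Base as ℤ
import Data.Integer.Properties as ℤ
import Data.Integer.Solver as ℤSolver
open import Data.Integer.Base using (ℤ; +_; -[1+_])
open import Data.List.Base as List
  using (List; []; _∷_; _++_; _∷ʳ_; length; foldl; take; drop; tabulate; allFin; cartesianProductWith)
open import Data.List.Membership.Propositional using (_∈_)
open import Data.List.Membership.Propositional.Properties using (∈-cartesianProductWith⁺; ∈-allFin)
import Data.List.Properties as List
open import Data.List.Relation.Unary.All using (All; []; _∷_)
import Data.List.Relation.Unary.All.Properties as All
open import Data.List.Relation.Unary.AllPairs using (AllPairs; []; _∷_)
import Data.List.Relation.Unary.AllPairs.Properties as AllPairs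
open import Data.List.Relation.Unary.Any as Any using (here; there)
import Data.List.Relation.Unary.Any.Properties as Any
import Data.Nat.Base as ℕ
import Data.Nat.Coprimality as ℕ
import Data.Nat.Properties as ℕ
import Data.Nat.Solver as ℕSolver
open import Data.Nat.Base using (ℕ; zero; suc; z≤n; s≤s)
open import Data.Product.Base using (_×_; _,_; ∃-syntax; Σ-syntax; proj₁; proj₂)
import Data.Rational.Base as ℚ
import Data.Rational.Properties as ℚ
open import Data.Rational.Base using (ℚ; 0ℚ; 1ℚ; mkℚ; *≤*; *<*)
open import Data.Sum.Base using (_⊎_; inj₁; inj₂; [_,_]′)
open import Data.Vec.Base using (Vec; []; _∷_)
open import Data.Vec.Functional using (Vector; updateAt)
open import Data.Vec.Functional.Properties using (updateAt-updates; updateAt-minimal)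
import Data.Vec.Properties as Vec
open import Function.Base using (_∘_)
open import Function.Bundles using (mk⇔)
open import Relation.Binary.PropositionalEquality as ≡
  using (_≡_; _≢_; refl; sym; trans; cong; cong₂; subst)
import Relation.Binary.Reasoning.Setoid as SetoidReasoning
open import Relation.Nullary.Decidable
  using (Dec; yes; no; does; dec-true; dec-false; map′; _×-dec_; _⊎-dec_; ¬?; decidable-stable)
open import Relation.Nullary.Negation using (¬_; contradiction)

-- By Felikson–Shapiro–Thomas–Tumarkin's criterion, an infinite mutation class contains a
-- matrix with an entry |b_pq| ≥ 3 and a third index r joined to p or q: if no matrix of the
-- class is of this form, μ_k produces no new entry |b_ij| ≥ 3, so the entries stay bounded.  So
-- a search of bounded depth finds the matrix, and no classical logic is needed.
-- A few mutations at p, q, r turn the triangle into a fork: a cyclic triangle with all weights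
-- ≥ 2 in which the weight opposite to some k is the largest.  Mutating a fork at either vertex
-- other than k gives a fork for that vertex, so a binary tree of seeds grows out of it.
--
-- To separate the leaves, express cluster variables in those of the root T of the tree and
-- evaluate at distinct rationals ≥ 1, largest at k.  As v_p v_p′ > v_k² and v_k is the
-- largest value, the new value v_p′ is larger still, so the largest value of a seed marks the
-- vertex mutated last.  Hence a permutation that identifies two leaves also identifies
-- their parents, and so on back to T, where the distinct values force it to be the identity.

-- Specialization of rational functions

module Specialization
  (S : IntegralDomain) {ι : ℚ → IntegralDomain.Carrier S}
  (I : IsHom ℚ.+-*-commutativeRing (IntegralDomain.commutativeRing S) ι)
  {n : ℕ} (t : Vector (IntegralDomain.Carrier S) n) (z : Vector ℚ n) where
  open IntegralDomain S renaming (refl to ≈-refl; sym to ≈-sym; trans to ≈-trans)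
  open SetoidReasoning setoid using (begin_; step-≈-⟩; step-≈-⟨; _∎)
  open Solver commutativeSemiring using (solve; _:+_; _:*_; _:=_)
  open RawSemiringDefs (Semiring.rawSemiring semiring) using (_^_; product)
  open Exchange commutativeRing
  private
    module P = Polynomial n
    module Q = IntegralDomain ℚ-domain
    module QS = Solver Q.commutativeSemiring
    module QR = RawSemiringDefs (Semiring.rawSemiring Q.semiring)
    module QE = Exchange ℚ.+-*-commutativeRing

  at-t : P.Carrier → Carrier
  at-t p = Evaluation.eval commutativeRing ι n p t

  at-z : P.Carrier → ℚ
  at-z p = Evaluation.eval ℚ.+-*-commutativeRing (λ c → c) n p z

  private
    module T = IsHom (EvalHom.evalHom commutativeRing I n t)
    module Z = IsHom (EvalHom.evalHom ℚ.+-*-commutativeRing (idHom _) n z)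

  -- g is a quotient of polynomials in t whose specialization t ↦ z is defined and equals v.
  record HasValue (g : Carrier) (v : ℚ) : Set where
    field
      numer denom : P.Carrier
      denom≢0     : at-z denom ≢ 0ℚ
      fraction    : g * at-t denom ≈ at-t numer
      value       : at-z numer ≡ v ℚ.* at-z denom
  open HasValue

  polynomial-value : ∀ {g v} p → g ≈ at-t p → at-z p ≡ v → HasValue g v
  polynomial-value {v = v} p g≈ p≡ = record
    { numer = p ; denom = P.1#
    ; denom≢0 = λ e → Q.1≉0 (trans (sym Z.1-homo) e)
    ; fraction = ≈-trans (*-cong g≈ T.1-homo) (*-identityʳ _)
    ; value = trans p≡ (sym (trans (cong (v ℚ.*_) Z.1-homo) (ℚ.*-identityʳ v)))
    }

  variable-value : ∀ l → HasValue (t l) (z l)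
  variable-value l = polynomial-value (X n l)
    (≈-sym (EvalHom.eval-X commutativeRing I n l t))
    (EvalHom.eval-X ℚ.+-*-commutativeRing (idHom _) n l z)

  1-value : HasValue 1# 1ℚ
  1-value = polynomial-value P.1# (≈-sym T.1-homo) Z.1-homo

  *-value : ∀ {g h u v} → HasValue g u → HasValue h v → HasValue (g * h) (u ℚ.* v)
  *-value {g} {h} {u} {v} a b = record
    { numer = numer a P.* numer b ; denom = denom a P.* denom b
    ; denom≢0 = λ e → Q.*-≉0 (denom≢0 a) (denom≢0 b) (trans (sym (Z.*-homo _ _)) e)
    ; fraction = begin
        g * h * at-t (denom a P.* denom b)              ≈⟨ *-congˡ (T.*-homo _ _) ⟩
        g * h * (at-t (denom a) * at-t (denom b))
          ≈⟨ solve 4 (λ g h p q → g :* h :* (p :* q) := (g :* p) :* (h :* q)) ≈-refl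
               g h (at-t (denom a)) (at-t (denom b)) ⟩
        (g * at-t (denom a)) * (h * at-t (denom b))     ≈⟨ *-cong (fraction a) (fraction b) ⟩
        at-t (numer a) * at-t (numer b)                 ≈⟨ T.*-homo _ _ ⟨
        at-t (numer a P.* numer b)                      ∎
    ; value = trans (Z.*-homo _ _) (trans (cong₂ ℚ._*_ (value a) (value b))
        (trans (QS.solve 4 (λ u v p q → (u QS.:* p) QS.:* (v QS.:* q) QS.:= u QS.:* v QS.:* (p QS.:* q))
                   refl u v (at-z (denom a)) (at-z (denom b)))
          (cong (u ℚ.* v ℚ.*_) (sym (Z.*-homo _ _)))))
    }

  +-value : ∀ {g h u v} → HasValue g u → HasValue h v → HasValue (g + h) (u ℚ.+ v)
  +-value {g} {h} {u} {v} a b = record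
    { numer = numer a P.* denom b P.+ numer b P.* denom a ; denom = denom a P.* denom b
    ; denom≢0 = λ e → Q.*-≉0 (denom≢0 a) (denom≢0 b) (trans (sym (Z.*-homo _ _)) e)
    ; fraction = begin
        (g + h) * at-t (denom a P.* denom b)              ≈⟨ *-congˡ (T.*-homo _ _) ⟩
        (g + h) * (at-t (denom a) * at-t (denom b))
          ≈⟨ solve 4 (λ g h p q → (g :+ h) :* (p :* q) := (g :* p) :* q :+ (h :* q) :* p) ≈-refl
               g h (at-t (denom a)) (at-t (denom b)) ⟩
        (g * at-t (denom a)) * at-t (denom b) + (h * at-t (denom b)) * at-t (denom a)
          ≈⟨ +-cong (*-congʳ (fraction a)) (*-congʳ (fraction b)) ⟩
        at-t (numer a) * at-t (denom b) + at-t (numer b) * at-t (denom a)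
          ≈⟨ ≈-trans (T.+-homo _ _) (+-cong (T.*-homo _ _) (T.*-homo _ _)) ⟨
        at-t (numer a P.* denom b P.+ numer b P.* denom a) ∎
    ; value = trans (trans (Z.+-homo _ _) (cong₂ ℚ._+_ (Z.*-homo _ _) (Z.*-homo _ _)))
        (trans (cong₂ (λ p q → p ℚ.* at-z (denom b) ℚ.+ q ℚ.* at-z (denom a)) (value a) (value b))
        (trans (QS.solve 4 (λ u v p q → (u QS.:* p) QS.:* q QS.:+ (v QS.:* q) QS.:* p
                                 QS.:= (u QS.:+ v) QS.:* (p QS.:* q))
                   refl u v (at-z (denom a)) (at-z (denom b)))
          (cong ((u ℚ.+ v) ℚ.*_) (sym (Z.*-homo _ _)))))
    }

  ^-value : ∀ {g u} → HasValue g u → ∀ m → HasValue (g ^ m) (u QR.^ m)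
  ^-value a zero    = 1-value
  ^-value a (suc m) = *-value a (^-value a m)

  product-value : ∀ {m} {f : Vector Carrier m} {v : Vector ℚ m} (e : Vector ℕ m) →
    (∀ l → HasValue (f l) (v l)) →
    HasValue (product (λ l → f l ^ e l)) (QR.product (λ l → v l QR.^ e l))
  product-value {zero}  e a = 1-value
  product-value {suc m} e a = *-value (^-value (a zero) (e zero)) (product-value (e ∘ suc) (a ∘ suc))

  binomial-value : ∀ {m} {f : Vector Carrier m} {v : Vector ℚ m} (b : Vector ℤ m) →
    (∀ l → HasValue (f l) (v l)) → HasValue (binomial f b) (QE.binomial v b)
  binomial-value b a = +-value (product-value (λ j → [ b j ]₊) a) (product-value (λ j → [ ℤ.- b j ]₊) a)

  -- The numerator of `f` moves into the denominator of the quotient. It does not vanish at `z`,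
  -- since its value there is `u` times the nonzero value of the denominator of `f`. Describing `w`
  -- by `f * w ≈ g` fits the exchange relation `at-k`.
  quotient-value : ∀ {f g w u v x} → HasValue f u → HasValue g v → u ≢ 0ℚ →
    f * w ≈ g → u ℚ.* x ≡ v → HasValue w x
  quotient-value {f} {g} {w} {u} {v} {x} a b u≢0 fw≈g ux≡v = record
    { numer = numer b P.* denom a ; denom = numer a P.* denom b
    ; denom≢0 = λ e → Q.*-≉0 (Q.*-≉0 u≢0 (denom≢0 a)) (denom≢0 b)
        (trans (cong (ℚ._* at-z (denom b)) (sym (value a))) (trans (sym (Z.*-homo _ _)) e))
    ; fraction = begin
        w * at-t (numer a P.* denom b)                ≈⟨ *-congˡ (T.*-homo _ _) ⟩
        w * (at-t (numer a) * at-t (denom b))         ≈⟨ *-congˡ (*-congʳ (fraction a)) ⟨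
        w * (f * at-t (denom a) * at-t (denom b))
          ≈⟨ solve 4 (λ f w p q → w :* (f :* p :* q) := f :* w :* q :* p) ≈-refl
               f w (at-t (denom a)) (at-t (denom b)) ⟩
        f * w * at-t (denom b) * at-t (denom a)       ≈⟨ *-congʳ (*-congʳ fw≈g) ⟩
        g * at-t (denom b) * at-t (denom a)           ≈⟨ *-congʳ (fraction b) ⟩
        at-t (numer b) * at-t (denom a)               ≈⟨ T.*-homo _ _ ⟨
        at-t (numer b P.* denom a)                    ∎
    ; value = trans (Z.*-homo _ _) (trans (cong (ℚ._* at-z (denom a)) (value b))
        (trans (cong (λ y → y ℚ.* at-z (denom b) ℚ.* at-z (denom a)) (sym ux≡v))
        (trans (QS.solve 4 (λ u x p q → u QS.:* x QS.:* q QS.:* p QS.:= x QS.:* (u QS.:* p QS.:* q)) refl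
                    u x (at-z (denom a)) (at-z (denom b)))
          (cong (x ℚ.*_) (trans (cong (ℚ._* at-z (denom b)) (sym (value a))) (sym (Z.*-homo _ _)))))))
    }

  -- The exchange in the domain and the one in ℚ run in parallel: in direction `k` both divide a
  -- binomial by the old entry, elsewhere both keep it.
  exchange-value : ∀ {k b} {bₖ≡0 : b k ≡ + 0} {f g : Vector Carrier n} {v w : Vector ℚ n} →
    MutationIndependence.Exchanged S I k b bₖ≡0 f g →
    MutationIndependence.Exchanged ℚ-domain (idHom _) k b bₖ≡0 v w →
    v k ≢ 0ℚ → (∀ l → HasValue (f l) (v l)) → ∀ l → HasValue (g l) (w l)
  exchange-value {k} {b} {f = f} {g} {v} {w} r s vₖ≢0 a l with l ≟ k
  ... | yes refl =
    quotient-value (a k) (binomial-value b a) vₖ≢0 (R.at-k r) (R.at-k s)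
    where module R = MutationIndependence.Exchanged
  ... | no l≢k = record
    { numer = numer (a l) ; denom = denom (a l) ; denom≢0 = denom≢0 (a l)
    ; fraction = ≈-trans (*-congʳ (≈-sym (R.off-k r l≢k))) (fraction (a l))
    ; value = trans (value (a l)) (cong (ℚ._* at-z (denom (a l))) (R.off-k s l≢k)) }
    where module R = MutationIndependence.Exchanged

  module _ (independent : ∀ p → at-t p ≈ 0# → p P.≈ P.0#) where

    -- Clearing denominators turns `g ≈ h` into a polynomial relation between the `t l`.
    -- Independence lifts it to an identity of polynomials, and such an identity survives evaluation
    -- at `z`.
    value-unique : ∀ {g h u v} → g ≈ h → HasValue g u → HasValue h v → u ≡ v
    value-unique {g} {h} {u} {v} g≈h a b =
      Q.*-cancelʳ u v (at-z (denom a) ℚ.* at-z (denom b)) (Q.*-≉0 (denom≢0 a) (denom≢0 b)) (begin′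
        u ℚ.* (at-z (denom a) ℚ.* at-z (denom b))   ≡⟨ ℚ.*-assoc u _ _ ⟨
        u ℚ.* at-z (denom a) ℚ.* at-z (denom b)     ≡⟨ cong (ℚ._* _) (value a) ⟨
        at-z (numer a) ℚ.* at-z (denom b)           ≡⟨ Z.*-homo _ _ ⟨
        at-z (numer a P.* denom b)                  ≡⟨ Z.cong-homo cross-equal ⟩
        at-z (numer b P.* denom a)                  ≡⟨ Z.*-homo _ _ ⟩
        at-z (numer b) ℚ.* at-z (denom a)           ≡⟨ cong (ℚ._* _) (value b) ⟩
        v ℚ.* at-z (denom b) ℚ.* at-z (denom a)     ≡⟨ ℚ.*-assoc v _ _ ⟩
        v ℚ.* (at-z (denom b) ℚ.* at-z (denom a))
          ≡⟨ cong (v ℚ.*_) (ℚ.*-comm (at-z (denom b)) (at-z (denom a))) ⟩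
        v ℚ.* (at-z (denom a) ℚ.* at-z (denom b))   ∎′)
      where
      open ≡.≡-Reasoning using (step-≡-⟩; step-≡-⟨) renaming (begin_ to begin′_; _∎ to _∎′)
      difference : P.Carrier
      difference = numer a P.* denom b P.- numer b P.* denom a
      at-t-equal : at-t (numer a P.* denom b) ≈ at-t (numer b P.* denom a)
      at-t-equal = begin
        at-t (numer a P.* denom b)               ≈⟨ T.*-homo _ _ ⟩
        at-t (numer a) * at-t (denom b)          ≈⟨ *-congʳ (≈-trans (≈-sym (fraction a)) (*-congʳ g≈h)) ⟩
        h * at-t (denom a) * at-t (denom b)
          ≈⟨ solve 3 (λ h p q → h :* p :* q := h :* q :* p) ≈-refl h (at-t (denom a)) (at-t (denom b)) ⟩
        h * at-t (denom b) * at-t (denom a)      ≈⟨ *-congʳ (fraction b) ⟩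
        at-t (numer b) * at-t (denom a)          ≈⟨ T.*-homo _ _ ⟨
        at-t (numer b P.* denom a)               ∎
      cross-equal : numer a P.* denom b P.≈ numer b P.* denom a
      cross-equal = P.x∙y⁻¹≈ε⇒x≈y _ _ (independent difference (begin
        at-t difference
          ≈⟨ T.+-homo _ _ ⟩
        at-t (numer a P.* denom b) + at-t (P.- (numer b P.* denom a))
          ≈⟨ +-congʳ at-t-equal ⟩
        at-t (numer b P.* denom a) + at-t (P.- (numer b P.* denom a))
          ≈⟨ T.+-homo _ _ ⟨
        at-t (numer b P.* denom a P.- numer b P.* denom a)
          ≈⟨ T.cong-homo (P.-‿inverseʳ _) ⟩
        at-t P.0#
          ≈⟨ T.0-homo ⟩
        0# ∎))

-- Mutation of triangles

-- The dividend in `half` is always twice an integer, so the division is exact and has the closed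
-- form that `even` gives for each pair of signs.
half-even : ∀ a b → half a b ≡ proj₁ (even a b)
half-even a b = trans (cong (ℤ._/ + 2) (proj₂ (even a b))) (c*2/2≡c _)

half-comm : ∀ a b → half a b ≡ half b a
half-comm a b = cong (ℤ._/ + 2) (solve 4
  (λ a b u v → u :* b :+ a :* v := v :* a :+ b :* u) refl a b (+ ℤ.∣ a ∣) (+ ℤ.∣ b ∣))
  where open ℤSolver.+-*-Solver

half-neg : ∀ a b → half (ℤ.- a) (ℤ.- b) ≡ ℤ.- half a b
half-neg a b = begin
  half (ℤ.- a) (ℤ.- b)              ≡⟨ ℤ.neg-involutive _ ⟨
  ℤ.- (ℤ.- half (ℤ.- a) (ℤ.- b))    ≡⟨ cong ℤ.-_ (half-skew b a) ⟨
  ℤ.- half b a                      ≡⟨ cong ℤ.-_ (half-comm b a) ⟩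
  ℤ.- half a b                      ∎
  where open ≡.≡-Reasoning

half-nonneg : ∀ a b → half (+ a) (+ b) ≡ + (a ℕ.* b)
half-nonneg a b = trans (half-even (+ a) (+ b)) (sym (ℤ.pos-* a b))

half-nonpos : ∀ a b → half (ℤ.- + a) (ℤ.- + b) ≡ ℤ.- + (a ℕ.* b)
half-nonpos a b = trans (half-neg (+ a) (+ b)) (cong ℤ.-_ (half-nonneg a b))

module _ {n : ℕ} where

  μ-row : ∀ k (B : Matrix n) j → μ k B k j ≡ ℤ.- B k j
  μ-row k B j rewrite dec-true (k ≟ k) refl = refl

  μ-column : ∀ k (B : Matrix n) i → μ k B i k ≡ ℤ.- B i k
  μ-column k B i with does (i ≟ k)
  ... | true  = refl
  ... | false rewrite dec-true (k ≟ k) refl = refl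

  μ-off : ∀ {k i j} (B : Matrix n) → i ≢ k → j ≢ k → μ k B i j ≡ B i j ℤ.+ half (B i k) (B k j)
  μ-off {k} {i} {j} B i≢k j≢k rewrite dec-false (i ≟ k) i≢k | dec-false (j ≟ k) j≢k = refl

  μ-cong : ∀ k {B C : Matrix n} → B ≐ C → μ k B ≐ μ k C
  μ-cong k B≐C i j with does (i ≟ k) ∨ does (j ≟ k)
  ... | true  = cong ℤ.-_ (B≐C i j)
  ... | false = cong₂ ℤ._+_ (B≐C i j) (cong₂ half (B≐C i k) (B≐C k j))

  data Position (k : Fin n) : Fin n → Fin n → Set where
    row    : ∀ j → Position k k j
    column : ∀ i → Position k i k
    off    : ∀ {i j} → i ≢ k → j ≢ k → Position k i j

  position : ∀ k i j → Position k i j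
  position k i j with i ≟ k | j ≟ k
  ... | yes refl | _        = row j
  ... | no _     | yes refl = column i
  ... | no i≢k   | no j≢k   = off i≢k j≢k

  -- Off row and column `k` the second mutation adds `half` of the negated entries, which cancels
  -- what the first one added.
  μ-involutive : ∀ k (B : Matrix n) → μ k (μ k B) ≐ B
  μ-involutive k B i j with position k i j
  ... | row j = trans (μ-row k (μ k B) j) (trans (cong ℤ.-_ (μ-row k B j)) (ℤ.neg-involutive _))
  ... | column i = trans (μ-column k (μ k B) i) (trans (cong ℤ.-_ (μ-column k B i)) (ℤ.neg-involutive _))
  ... | off i≢k j≢k = begin
    μ k (μ k B) i j
      ≡⟨ μ-off (μ k B) i≢k j≢k ⟩
    μ k B i j ℤ.+ half (μ k B i k) (μ k B k j)
      ≡⟨ cong₂ ℤ._+_ (μ-off B i≢k j≢k) (cong₂ half (μ-column k B i) (μ-row k B j)) ⟩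
    B i j ℤ.+ half (B i k) (B k j) ℤ.+ half (ℤ.- B i k) (ℤ.- B k j)
      ≡⟨ cong (λ h → B i j ℤ.+ half (B i k) (B k j) ℤ.+ h) (half-neg (B i k) (B k j)) ⟩
    B i j ℤ.+ half (B i k) (B k j) ℤ.- half (B i k) (B k j)
      ≡⟨ solve 2 (λ u v → u :+ v :- v := u) refl (B i j) (half (B i k) (B k j)) ⟩
    B i j ∎
    where
    open ≡.≡-Reasoning
    open ℤSolver.+-*-Solver

  μ-relabel : ∀ (σ : Fin n → Fin n) → (∀ {i j} → σ i ≡ σ j → i ≡ j) → ∀ k (B : Matrix n) i j →
              μ (σ k) B (σ i) (σ j) ≡ μ k (λ i j → B (σ i) (σ j)) i j
  μ-relabel σ injective k B i j with position k i j
  ... | row j       = trans (μ-row (σ k) B (σ j)) (sym (μ-row k (λ i j → B (σ i) (σ j)) j))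
  ... | column i    = trans (μ-column (σ k) B (σ i)) (sym (μ-column k (λ i j → B (σ i) (σ j)) i))
  ... | off i≢k j≢k = trans (μ-off B (i≢k ∘ injective) (j≢k ∘ injective))
                            (sym (μ-off (λ i j → B (σ i) (σ j)) i≢k j≢k))

  -- The entries are read along the cycle p → q → r → p, so the triangle is cyclically oriented
  -- exactly when all three are nonzero and of one sign.
  record Triangle (B : Matrix n) (p q r : Fin n) (x y z : ℤ) : Set where
    field
      skew : SkewSymmetric B
      p≢q  : p ≢ q
      q≢r  : q ≢ r
      r≢p  : r ≢ p
      pq   : B p q ≡ x
      qr   : B q r ≡ y
      rp   : B r p ≡ z

  reweigh : ∀ {B p q r x x′ y y′ z z′} → x ≡ x′ → y ≡ y′ → z ≡ z′ →
            Triangle B p q r x y z → Triangle B p q r x′ y′ z′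
  reweigh refl refl refl t = t

  rotate : ∀ {B p q r x y z} → Triangle B p q r x y z → Triangle B q r p y z x
  rotate t = record { skew = skew ; p≢q = q≢r ; q≢r = r≢p ; r≢p = p≢q ; pq = qr ; qr = rp ; rp = pq }
    where open Triangle t

  flip : ∀ {B p q r x y z} → Triangle B p q r x y z → Triangle B q p r (ℤ.- x) (ℤ.- z) (ℤ.- y)
  flip t = record
    { skew = skew ; p≢q = p≢q ∘ sym ; q≢r = r≢p ∘ sym ; r≢p = q≢r ∘ sym
    ; pq = trans (skew _ _) (cong ℤ.-_ pq)
    ; qr = trans (skew _ _) (cong ℤ.-_ rp)
    ; rp = trans (skew _ _) (cong ℤ.-_ qr) }
    where open Triangle t

  -- Mutation at `p` negates the edges at `p`, and reading the vertices in the order q, p, r negates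
  -- them once more. So only the weight opposite to `p` changes.
  mutate-triangle : ∀ {B p q r x y z} → Triangle B p q r x y z →
                    Triangle (μ p B) q p r x z (half z x ℤ.- y)
  mutate-triangle {B} {p} {q} {r} {x} {y} {z} t = record
    { skew = μ-skew p B skew ; p≢q = p≢q ∘ sym ; q≢r = r≢p ∘ sym ; r≢p = q≢r ∘ sym
    ; pq = trans (μ-column p B q) (trans (sym (skew p q)) pq)
    ; qr = trans (μ-row p B r) (trans (sym (skew r p)) rp)
    ; rp = trans (μ-off B r≢p (p≢q ∘ sym)) (trans
        (cong₂ ℤ._+_ (trans (skew r q) (cong ℤ.-_ qr)) (cong₂ half rp pq))
        (ℤ.+-comm (ℤ.- y) (half z x))) }
    where open Triangle t

  -- The new weight is ca - b; the equation `b + d ≡ c * a` names it without truncated subtraction.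
  mutate-cyclic : ∀ {B p q r a b c d} → Triangle B p q r (+ a) (+ b) (+ c) → b ℕ.+ d ≡ c ℕ.* a →
                  Triangle (μ p B) q p r (+ a) (+ c) (+ d)
  mutate-cyclic {a = a} {b} {c} {d} t b+d≡ca =
    reweigh refl refl third (mutate-triangle t)
    where
    third : half (+ c) (+ a) ℤ.- + b ≡ + d
    third = trans (cong (ℤ._- + b) (trans (half-nonneg c a) (cong +_ (sym b+d≡ca))))
      (trans (cong (ℤ._- + b) (ℤ.pos-+ b d))
        (solve 2 (λ b d → b :+ d :- b := d) refl (+ b) (+ d)))
      where open ℤSolver.+-*-Solver

  -- The path r → p → q is parallel to the edge r → q, so the product of its weights is added to
  -- `b`. The edges at `p` are reversed, which closes the cycle.
  mutate-acyclic : ∀ {B p q r a b c} → Triangle B p q r (+ a) (ℤ.- + b) (+ c) →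
                   Triangle (μ p B) q p r (+ a) (+ c) (+ (c ℕ.* a ℕ.+ b))
  mutate-acyclic {a = a} {b} {c} t =
    reweigh refl refl third (mutate-triangle t)
    where
    third : half (+ c) (+ a) ℤ.- (ℤ.- + b) ≡ + (c ℕ.* a ℕ.+ b)
    third = trans (cong₂ ℤ._+_ (half-nonneg c a) (ℤ.neg-involutive (+ b))) (sym (ℤ.pos-+ _ b))

  -- Here `r` is the middle vertex: the path p → r → q is parallel to p → q and adds to the weight
  -- `a`. Rotations and a flip bring `r` to the mutated position and back.
  mutate-middle : ∀ {B p q r a b c} → Triangle B p q r (+ a) (ℤ.- + b) (ℤ.- + c) →
                  Triangle (μ r B) p q r (+ (b ℕ.* c ℕ.+ a)) (+ b) (+ c)
  mutate-middle {a = a} {b} {c} t =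
    reweigh second (ℤ.neg-involutive (+ b)) (ℤ.neg-involutive (+ c))
      (rotate (flip (mutate-triangle (rotate (rotate t)))))
    where
    second : ℤ.- (half (ℤ.- + b) (ℤ.- + c) ℤ.- + a) ≡ + (b ℕ.* c ℕ.+ a)
    second = trans (cong (λ h → ℤ.- (h ℤ.- + a)) (half-nonpos b c))
      (trans (solve 2 (λ m a → :- (:- m :- a) := m :+ a) refl (+ (b ℕ.* c)) (+ a))
        (sym (ℤ.pos-+ (b ℕ.* c) a)))
      where open ℤSolver.+-*-Solver

  -- A cyclic triangle with weights ≥ 2 whose weight opposite to k is the largest; such
  -- quivers are Warkentin's forks with point of return k.
  record Fork (B : Matrix n) (i j k : Fin n) : Set where
    constructor fork
    field
      {a b c}  : ℕ
      triangle : Triangle B i j k (+ a) (+ b) (+ c)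
      b<a      : b ℕ.< a
      c<a      : c ℕ.< a
      2≤b      : 2 ℕ.≤ b
      2≤c      : 2 ℕ.≤ c
    open Triangle triangle public
      renaming (p≢q to i≢j; q≢r to j≢k; r≢p to k≢i; pq to ij; qr to jk; rp to ki)

-- The difference of the two sides is (a - 1)(c - 1) - 1, and (a - 1)(c - 1) ≥ 2.
sum<product : ∀ {a c} → 3 ℕ.≤ a → 2 ℕ.≤ c → c ℕ.+ a ℕ.< c ℕ.* a
sum<product {a} {suc (suc c)} 3≤a (s≤s (s≤s _)) = begin-strict
  2 ℕ.+ c ℕ.+ a           <⟨ ℕ.+-monoˡ-< a (ℕ.+-monoˡ-≤ c 3≤a) ⟩
  a ℕ.+ c ℕ.+ a           ≤⟨ ℕ.+-monoˡ-≤ a (ℕ.+-monoʳ-≤ a c≤ca) ⟩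
  a ℕ.+ c ℕ.* a ℕ.+ a     ≡⟨ ℕ.+-comm _ a ⟩
  a ℕ.+ (a ℕ.+ c ℕ.* a)   ∎
  where
  open ℕ.≤-Reasoning
  c≤ca : c ℕ.≤ c ℕ.* a
  c≤ca = subst (ℕ._≤ c ℕ.* a) (ℕ.*-identityʳ c) (ℕ.*-monoʳ-≤ c (ℕ.≤-trans (s≤s z≤n) 3≤a))

double<product : ∀ {a c} → 3 ℕ.≤ a → 1 ℕ.≤ c → c ℕ.+ c ℕ.< c ℕ.* a
double<product {a} {c} 3≤a 1≤c = begin-strict
  c ℕ.+ c                 <⟨ ℕ.m<m+n _ 1≤c ⟩
  c ℕ.+ c ℕ.+ c           ≡⟨ solve 1 (λ c → c :+ c :+ c := c :* con 3) refl c ⟩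
  c ℕ.* 3                 ≤⟨ ℕ.*-monoʳ-≤ c 3≤a ⟩
  c ℕ.* a                 ∎
  where
  open ℕ.≤-Reasoning
  open ℕSolver.+-*-Solver

cancel-< : ∀ {b d m s} → b ℕ.+ d ≡ s → b ℕ.+ m ℕ.< s → m ℕ.< d
cancel-< {b} refl lt = ℕ.+-cancelˡ-< b _ _ lt

complement : ∀ {b s} → b ℕ.≤ s → ∃[ d ] b ℕ.+ d ≡ s
complement b≤s = _ , ℕ.m+[n∸m]≡n b≤s

-- Reaching forks from heavy triangles

module _ {n : ℕ} where

  private
    doubled : ∀ {a b c} → b ℕ.< a → 2 ℕ.≤ c → b ℕ.+ a ℕ.< c ℕ.* a
    doubled {a} {b} {c} b<a 2≤c = begin-strict
      b ℕ.+ a         <⟨ ℕ.+-monoˡ-< a b<a ⟩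
      a ℕ.+ a         ≡⟨ cong (a ℕ.+_) (ℕ.+-identityʳ a) ⟨
      2 ℕ.* a         ≤⟨ ℕ.*-monoˡ-≤ a 2≤c ⟩
      c ℕ.* a         ∎
      where open ℕ.≤-Reasoning

  -- The weight `b` opposite to `i` becomes d = ca - b. As b + a < 2a ≤ ca, this exceeds `a`, so the
  -- edge opposite to `i` is now the heaviest and `i` is the new point of return.
  fork-mutateˡ : ∀ {B : Matrix n} {i j k} → Fork B i j k → Fork (μ i B) k j i
  fork-mutateˡ (fork {a} {b} {c} t b<a c<a 2≤b 2≤c)
    with b+a<ca ← doubled b<a 2≤c
    with d , b+d≡ca ← complement {b} {c ℕ.* a} (ℕ.≤-trans (ℕ.m≤m+n b a) (ℕ.<⇒≤ b+a<ca))
    with a<d ← cancel-< b+d≡ca b+a<ca =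
    fork (rotate (rotate (mutate-cyclic t b+d≡ca))) a<d (ℕ.<-trans c<a a<d)
      (ℕ.≤-trans 2≤b (ℕ.<⇒≤ b<a)) 2≤c

  fork-mutateʳ : ∀ {B : Matrix n} {i j k} → Fork B i j k → Fork (μ j B) i k j
  fork-mutateʳ (fork {a} {b} {c} t b<a c<a 2≤b 2≤c)
    with c+a<ba ← doubled c<a 2≤b
    with d , c+d≡ba ← complement {c} {a ℕ.* b}
           (ℕ.≤-trans (ℕ.m≤m+n c a) (subst (c ℕ.+ a ℕ.≤_) (ℕ.*-comm b a) (ℕ.<⇒≤ c+a<ba)))
    with a<d ← cancel-< c+d≡ba (subst (c ℕ.+ a ℕ.<_) (ℕ.*-comm b a) c+a<ba) =
    fork (rotate (rotate (mutate-cyclic (rotate t) c+d≡ba))) (ℕ.<-trans b<a a<d) a<d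
      2≤b (ℕ.≤-trans 2≤b (ℕ.<⇒≤ b<a))

  ReachesFork : Matrix n → Set
  ReachesFork B = ∃[ ks ] ∃[ i ] ∃[ j ] ∃[ k ] Fork (matrixMutations ks B) i j k

  reaches-now : ∀ {B i j k} → Fork B i j k → ReachesFork B
  reaches-now F = [] , _ , _ , _ , F

  reaches-later : ∀ {B} k → ReachesFork (μ k B) → ReachesFork B
  reaches-later k (ks , F) = k ∷ ks , F

  private
    -- Mutating at the vertex opposite to the weight 1 replaces it by ca - 1, which exceeds both `a`
    -- and `c` because c + a < ca.
    mutate-one : ∀ {B : Matrix n} {p q r a c} → 3 ℕ.≤ a → 3 ℕ.≤ c →
                 Triangle B p q r (+ a) (+ 1) (+ c) → ReachesFork B
    mutate-one {a = a} {c} 3≤a 3≤c t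
      with c+a<ca ← sum<product 3≤a (ℕ.≤-trans (ℕ.n≤1+n 2) 3≤c)
      with d , e ← complement {1} {c ℕ.* a}
             (ℕ.≤-trans (ℕ.≤-trans (s≤s z≤n) (ℕ.≤-trans 3≤c (ℕ.m≤m+n c a))) (ℕ.<⇒≤ c+a<ca)) =
      reaches-later _ (reaches-now (fork (rotate (rotate (mutate-cyclic t e)))
        (cancel-< e (ℕ.≤-<-trans (ℕ.+-monoˡ-≤ a (ℕ.≤-trans (s≤s z≤n) 3≤c)) c+a<ca))
        (cancel-< e (ℕ.≤-<-trans (ℕ.≤-trans (ℕ.+-monoˡ-≤ c (ℕ.≤-trans (s≤s z≤n) 3≤a))
                                             (ℕ.≤-reflexive (ℕ.+-comm a c))) c+a<ca))
        (ℕ.≤-trans (ℕ.n≤1+n 2) 3≤a) (ℕ.≤-trans (ℕ.n≤1+n 2) 3≤c)))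

  -- These are the triangles that `mutate-acyclic` produces. If b ≥ 2, then c ≥ ba > b + a is the
  -- largest weight and the triangle is a fork. If b = 1, then c ≥ a ≥ 3 and `mutate-one` applies.
  mutated-acyclic : ∀ {B : Matrix n} {p q r a b c} → 3 ℕ.≤ a → 1 ℕ.≤ b → b ℕ.* a ℕ.≤ c →
    Triangle B p q r (+ a) (+ b) (+ c) ⊎ Triangle B p q r (+ b) (+ a) (+ c) → ReachesFork B
  mutated-acyclic {a = a} {suc zero} {c} 3≤a _ a≤c =
    [ mutate-one 3≤a 3≤c , (λ t → mutate-one 3≤c 3≤a (rotate (rotate t))) ]′
    where
    3≤c : 3 ℕ.≤ c
    3≤c = ℕ.≤-trans 3≤a (ℕ.≤-trans (ℕ.≤-reflexive (sym (ℕ.+-identityʳ a))) a≤c)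
  mutated-acyclic {a = a} {b@(suc (suc _))} {c} 3≤a _ ba≤c =
    [ (λ t → reaches-now (fork (rotate (rotate t)) a<c b<c 2≤a (s≤s (s≤s z≤n))))
    , (λ t → reaches-now (fork (rotate (rotate t)) b<c a<c (s≤s (s≤s z≤n)) 2≤a)) ]′
    where
    2≤a : 2 ℕ.≤ a
    2≤a = ℕ.≤-trans (ℕ.n≤1+n 2) 3≤a
    b+a<c : b ℕ.+ a ℕ.< c
    b+a<c = ℕ.<-≤-trans (sum<product {a} {b} 3≤a (s≤s (s≤s z≤n))) ba≤c
    a<c : a ℕ.< c
    a<c = ℕ.≤-<-trans (ℕ.m≤n+m a b) b+a<c
    b<c : b ℕ.< c
    b<c = ℕ.≤-<-trans (ℕ.m≤m+n b a) b+a<c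

  -- Mutate at the vertex opposite to the smaller of `b` and `c`: the new weight max(b, c) · a -
  -- min(b, c) exceeds `a` and max(b, c), unless b = c = 1.
  cyclic-reaches-fork : ∀ {B : Matrix n} {p q r a b c} → 3 ℕ.≤ a → 1 ℕ.≤ b → 1 ℕ.≤ c →
    Triangle B p q r (+ a) (+ b) (+ c) → ReachesFork B
  cyclic-reaches-fork {a = a} {b} {c} 3≤a 1≤b 1≤c t with ℕ.≤-<-connex b c
  -- Weights a, 1, 1 take two mutations: the first gives a, 1, a - 1, and the second replaces the 1
  -- by (a - 1)a - 1, the largest weight of a fork.
  cyclic-reaches-fork {a = a} {b} {suc zero} 3≤a 1≤b _ t | inj₁ b≤1
    with refl ← ℕ.≤-antisym b≤1 1≤b
    with d , refl ← complement {1} {a} (ℕ.≤-trans (s≤s z≤n) 3≤a)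
    with d+a<da ← sum<product 3≤a (ℕ.s≤s⁻¹ 3≤a)
    with e , 1+e≡da ← complement {1} {d ℕ.* suc d} (ℕ.≤-trans (s≤s z≤n) d+a<da) =
    reaches-later _ (reaches-later _ (reaches-now (fork
      (rotate (rotate (mutate-cyclic (mutate-cyclic t (sym (ℕ.+-identityʳ _))) 1+e≡da)))
      a<e (ℕ.<-trans (ℕ.n<1+n d) a<e) (ℕ.≤-trans (ℕ.n≤1+n 2) 3≤a) (ℕ.s≤s⁻¹ 3≤a))))
    where
    a<e : suc d ℕ.< e
    a<e = cancel-< 1+e≡da (ℕ.≤-<-trans (ℕ.+-monoˡ-≤ (suc d) (ℕ.≤-trans (s≤s z≤n) (ℕ.s≤s⁻¹ 3≤a))) d+a<da)
  cyclic-reaches-fork {a = a} {b} {c@(suc (suc _))} 3≤a 1≤b 1≤c t | inj₁ b≤c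
    with c+a<ca ← sum<product {a} {c} 3≤a (s≤s (s≤s z≤n))
    with d , e ← complement {b} {c ℕ.* a} (ℕ.≤-trans (ℕ.≤-trans b≤c (ℕ.m≤m+n c a)) (ℕ.<⇒≤ c+a<ca)) =
    reaches-later _ (reaches-now (fork (rotate (rotate (mutate-cyclic t e)))
      (cancel-< e (ℕ.≤-<-trans (ℕ.+-monoˡ-≤ a b≤c) c+a<ca))
      (cancel-< e (ℕ.≤-<-trans (ℕ.+-monoˡ-≤ c b≤c) (double<product 3≤a 1≤c)))
      (ℕ.≤-trans (ℕ.n≤1+n 2) 3≤a) (s≤s (s≤s z≤n))))
  cyclic-reaches-fork {a = a} {b} {c} 3≤a 1≤b 1≤c t | inj₂ c<b
    with 2≤b ← ℕ.≤-trans (s≤s 1≤c) c<b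
    with b+a<ba ← sum<product {a} {b} 3≤a 2≤b
    with d , e ← complement {c} {b ℕ.* a}
           (ℕ.≤-trans (ℕ.≤-trans (ℕ.<⇒≤ c<b) (ℕ.m≤m+n b a)) (ℕ.<⇒≤ b+a<ba)) =
    reaches-later _ (reaches-now (fork
      (rotate (rotate (mutate-cyclic (rotate t) (trans e (ℕ.*-comm b a)))))
      (cancel-< e (ℕ.≤-<-trans (ℕ.+-monoˡ-≤ b (ℕ.<⇒≤ c<b)) (double<product 3≤a 1≤b)))
      (cancel-< e (ℕ.≤-<-trans (ℕ.+-monoˡ-≤ a (ℕ.<⇒≤ c<b)) b+a<ba))
      2≤b (ℕ.≤-trans (ℕ.n≤1+n 2) 3≤a)))

  nonneg-reaches-fork : ∀ {B : Matrix n} {p q r a b c} → 3 ℕ.≤ a → b ≢ 0 ⊎ c ≢ 0 →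
    Triangle B p q r (+ a) (+ b) (+ c) → ReachesFork B
  nonneg-reaches-fork {b = zero}  {zero}  3≤a b,c≢0 t = [ contradiction refl , contradiction refl ]′ b,c≢0
  nonneg-reaches-fork {b = zero}  {suc c} 3≤a _ t =
    reaches-later _ (mutated-acyclic 3≤a (s≤s z≤n) (ℕ.m≤m+n _ 0) (inj₁ (mutate-acyclic t)))
  nonneg-reaches-fork {b = suc b} {zero}  3≤a _ t =
    reaches-later _ (mutated-acyclic 3≤a (s≤s z≤n)
      (ℕ.≤-trans (ℕ.≤-reflexive (ℕ.*-comm (suc b) _)) (ℕ.m≤m+n _ 0))
      (inj₂ (mutate-acyclic {b = 0} (rotate t))))
  nonneg-reaches-fork {b = suc b} {suc c} 3≤a _ t = cyclic-reaches-fork 3≤a (s≤s z≤n) (s≤s z≤n) t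

  -- If `p` or `q` is the middle of an acyclic triangle, mutating there closes the cycle. If no edge
  -- at `r` has positive sign, mutating at `r` makes both nonnegative, and the weight of p → q does
  -- not decrease.
  positive-reaches-fork : ∀ {B : Matrix n} {p q r a y z} → 3 ℕ.≤ a → y ≢ + 0 ⊎ z ≢ + 0 →
    Triangle B p q r (+ a) y z → ReachesFork B
  positive-reaches-fork {y = + b} {+ c} 3≤a y,z≢0 t =
    nonneg-reaches-fork 3≤a ([ (λ e → inj₁ (e ∘ cong +_)) , (λ e → inj₂ (e ∘ cong +_)) ]′ y,z≢0) t
  positive-reaches-fork {a = a} {y = + suc b} { -[1+ c ]} 3≤a _ t =
    reaches-later _ (mutated-acyclic 3≤a (s≤s z≤n)
      (ℕ.≤-trans (ℕ.≤-reflexive (ℕ.*-comm (suc b) a)) (ℕ.m≤m+n _ (suc c)))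
      (inj₂ (mutate-acyclic {b = suc c} (rotate t))))
  positive-reaches-fork {y = -[1+ b ]} {+ suc c} 3≤a _ t =
    reaches-later _ (mutated-acyclic 3≤a (s≤s z≤n) (ℕ.m≤m+n _ (suc b))
      (inj₁ (mutate-acyclic {b = suc b} t)))
  positive-reaches-fork {y = + zero} { -[1+ c ]} 3≤a _ t =
    reaches-later _ (nonneg-reaches-fork 3≤a (inj₂ λ ()) (mutate-middle {b = 0} {c = suc c} t))
  positive-reaches-fork {y = -[1+ b ]} {+ zero} 3≤a _ t =
    reaches-later _ (nonneg-reaches-fork (ℕ.≤-trans 3≤a (ℕ.m≤n+m _ (b ℕ.* 0))) (inj₁ λ ())
      (mutate-middle {b = suc b} {c = 0} t))
  positive-reaches-fork {a = a} {y = -[1+ b ]} { -[1+ c ]} 3≤a _ t =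
    reaches-later _ (nonneg-reaches-fork (ℕ.≤-trans 3≤a (ℕ.m≤n+m a (suc b ℕ.* suc c))) (inj₁ λ ())
      (mutate-middle {b = suc b} {c = suc c} t))

  heavy-reaches-fork : ∀ {B : Matrix n} {p q r x y z} → 3 ℕ.≤ ℤ.∣ x ∣ → y ≢ + 0 ⊎ z ≢ + 0 →
    Triangle B p q r x y z → ReachesFork B
  heavy-reaches-fork {x = + a}      3≤∣x∣ y,z≢0 t = positive-reaches-fork 3≤∣x∣ y,z≢0 t
  heavy-reaches-fork {x = -[1+ a ]} 3≤∣x∣ y,z≢0 t = positive-reaches-fork 3≤∣x∣
    ([ (λ e → inj₂ (e ∘ ℤ.neg-injective {j = + 0}))
     , (λ e → inj₁ (e ∘ ℤ.neg-injective {j = + 0})) ]′ y,z≢0)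
    (flip t)

-- Bounded mutation classes

vector-bound : ∀ {n} (v : Vector ℕ n) → ∃[ M ] (∀ i → v i ℕ.≤ M)
vector-bound {zero}  v = 0 , λ ()
vector-bound {suc n} v with vector-bound (v ∘ suc)
... | M , v≤M = v zero ℕ.⊔ M ,
  λ { zero → ℕ.m≤m⊔n _ M ; (suc i) → ℕ.≤-trans (v≤M i) (ℕ.m≤n⊔m (v zero) M) }

signed-code : ∀ {M} z → ℤ.∣ z ∣ ℕ.≤ M → Fin (2 ℕ.* suc M)
signed-code (+ m)    m≤M = combine {2} zero (fromℕ< (s≤s m≤M))
signed-code -[1+ m ] m≤M = combine {2} (suc zero) (fromℕ< (s≤s m≤M))

signed-code-injective : ∀ {M} z w (z≤M : ℤ.∣ z ∣ ℕ.≤ M) (w≤M : ℤ.∣ w ∣ ℕ.≤ M) →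
                        signed-code z z≤M ≡ signed-code w w≤M → z ≡ w
signed-code-injective (+ a) (+ b) a≤M b≤M e =
  cong +_ (Fin.fromℕ<-injective _ _ (s≤s a≤M) (s≤s b≤M) (proj₂ (combine-injective {2} zero _ zero _ e)))
signed-code-injective -[1+ a ] -[1+ b ] a≤M b≤M e = cong -[1+_] (ℕ.suc-injective
  (Fin.fromℕ<-injective _ _ (s≤s a≤M) (s≤s b≤M)
    (proj₂ (combine-injective {2} (suc zero) _ (suc zero) _ e))))
signed-code-injective (+ a) -[1+ b ] a≤M b≤M e
  with () ← proj₁ (combine-injective {2} zero (fromℕ< (s≤s a≤M)) (suc zero) (fromℕ< (s≤s b≤M)) e)
signed-code-injective -[1+ a ] (+ b) a≤M b≤M e
  with () ← proj₁ (combine-injective {2} (suc zero) (fromℕ< (s≤s a≤M)) zero (fromℕ< (s≤s b≤M)) e)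

funToFin-injective : ∀ {m n} {f g : Fin m → Fin n} → funToFin f ≡ funToFin g → ∀ i → f i ≡ g i
funToFin-injective {f = f} {g} e i =
  trans (sym (finToFun-funToFin f i)) (trans (cong (λ c → Fin.finToFun c i) e) (finToFun-funToFin g i))

module _ {n : ℕ} where

  Bounded : ℕ → Matrix n → Set
  Bounded M B = ∀ i j → ℤ.∣ B i j ∣ ℕ.≤ M

  -- An entry is coded by its sign and its absolute value, hence the base 2(M + 1). For the
  -- pigeonhole argument an upper bound on the number of bounded matrices is enough.
  codes : ℕ → ℕ
  codes M = ((2 ℕ.* suc M) ℕ.^ n) ℕ.^ n

  code : ∀ {M} (B : Matrix n) → Bounded M B → Fin (codes M)
  code B b = funToFin λ i → funToFin λ j → signed-code (B i j) (b i j)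

  code-injective : ∀ {M} B C (b : Bounded M B) (c : Bounded M C) → code B b ≡ code C c → B ≐ C
  code-injective B C b c e i j = signed-code-injective (B i j) (C i j) (b i j) (c i j)
    (funToFin-injective (funToFin-injective e i) j)

  matrix-bound : ∀ (B : Matrix n) → ∃[ M ] 2 ℕ.≤ M × Bounded M B
  matrix-bound B with vector-bound (λ i → proj₁ (vector-bound (λ j → ℤ.∣ B i j ∣)))
  ... | M , rows≤M = 2 ℕ.⊔ M , ℕ.m≤m⊔n 2 M , λ i j →
    ℕ.≤-trans (proj₂ (vector-bound (λ j → ℤ.∣ B i j ∣)) j) (ℕ.≤-trans (rows≤M i) (ℕ.m≤n⊔m 2 M))

  Heavy : Matrix n → Set
  Heavy B = ∃[ p ] ∃[ q ] ∃[ r ]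
    p ≢ q × q ≢ r × r ≢ p × 3 ℕ.≤ ℤ.∣ B p q ∣ × (B q r ≢ + 0 ⊎ B r p ≢ + 0)

  heavy? : ∀ B → Dec (Heavy B)
  heavy? B = any? λ p → any? λ q → any? λ r →
    ¬? (p ≟ q) ×-dec ¬? (q ≟ r) ×-dec ¬? (r ≟ p) ×-dec
    (3 ℕ.≤? ℤ.∣ B p q ∣) ×-dec (¬? (B q r ℤ.≟ + 0) ⊎-dec ¬? (B r p ℤ.≟ + 0))

  heavy-within? : ∀ N B → Dec (∃[ ks ] length ks ℕ.≤ N × Heavy (matrixMutations ks B))
  heavy-within? zero    B = map′ (λ h → [] , z≤n , h) (λ { ([] , _ , h) → h }) (heavy? B)
  heavy-within? (suc N) B =
    map′ [ (λ h → [] , z≤n , h) , (λ { (k , ks , len , h) → k ∷ ks , s≤s len , h }) ]′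
         (λ { ([] , _ , h) → inj₁ h ; (k ∷ ks , s≤s len , h) → inj₂ (k , ks , len , h) })
         (heavy? B ⊎-dec any? λ k → heavy-within? N (μ k B))

  -- An entry that changes under μ k to absolute value ≥ 3 lies on a path through k, which makes it heavy.
  bounded-step : ∀ {M B} k → 2 ℕ.≤ M → SkewSymmetric B → ¬ Heavy (μ k B) →
    Bounded M B → Bounded M (μ k B)
  bounded-step {M} {B} k 2≤M skew light b i j with position k i j
  ... | row j    = subst (ℕ._≤ M) (sym (trans (cong ℤ.∣_∣ (μ-row k B j)) (ℤ.∣-i∣≡∣i∣ (B k j)))) (b k j)
  ... | column i = subst (ℕ._≤ M) (sym (trans (cong ℤ.∣_∣ (μ-column k B i)) (ℤ.∣-i∣≡∣i∣ (B i k)))) (b i k)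
  ... | off i≢k j≢k with ℕ.≤-<-connex ℤ.∣ μ k B i j ∣ 2
  ...   | inj₁ ≤2 = ℕ.≤-trans ≤2 2≤M
  ...   | inj₂ ≥3 = subst (λ z → ℤ.∣ z ∣ ℕ.≤ M) (sym unchanged) (b i j)
    where
    i≢j : i ≢ j
    i≢j refl with () ← subst (λ z → 3 ℕ.≤ ℤ.∣ z ∣) (skew-diagonal (μ-skew k B skew) i) ≥3
    -- The large entry (i, j) of `μ k B` would be heavy if `k` were joined to `i` or `j`, so both
    -- edges vanish. They vanish in `B` as well, and so does the correction `half (B i k) (B k j)`.
    jk≡0 : μ k B j k ≡ + 0
    jk≡0 = decidable-stable (_ ℤ.≟ _) λ ≢0 → light (i , j , k , i≢j , j≢k , i≢k ∘ sym , ≥3 , inj₁ ≢0)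
    ki≡0 : μ k B k i ≡ + 0
    ki≡0 = decidable-stable (_ ℤ.≟ _) λ ≢0 → light (i , j , k , i≢j , j≢k , i≢k ∘ sym , ≥3 , inj₂ ≢0)
    kj≡0 : B k j ≡ + 0
    kj≡0 = trans (skew k j) (trans (sym (μ-column k B j)) jk≡0)
    ik≡0 : B i k ≡ + 0
    ik≡0 = trans (skew i k) (trans (sym (μ-row k B i)) ki≡0)
    unchanged : μ k B i j ≡ B i j
    unchanged = trans (μ-off B i≢k j≢k)
      (trans (cong (λ h → B i j ℤ.+ h) (cong₂ half ik≡0 kj≡0)) (ℤ.+-identityʳ (B i j)))

  bounded-path : ∀ {M B} ks → 2 ℕ.≤ M → SkewSymmetric B → Bounded M B →
    (∀ ks′ → length ks′ ℕ.≤ length ks → ¬ Heavy (matrixMutations ks′ B)) →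
    Bounded M (matrixMutations ks B)
  bounded-path []       2≤M skew b light = b
  bounded-path (k ∷ ks) 2≤M skew b light = bounded-path ks 2≤M (μ-skew k _ skew)
    (bounded-step k 2≤M skew (light (k ∷ []) (s≤s z≤n)) b) (λ ks′ len → light (k ∷ ks′) (s≤s len))

  matrixMutations-cong : ∀ ks {B C : Matrix n} → B ≐ C → matrixMutations ks B ≐ matrixMutations ks C
  matrixMutations-cong []       B≐C = B≐C
  matrixMutations-cong (k ∷ ks) B≐C = matrixMutations-cong ks (μ-cong k B≐C)

  matrixMutations-skew : ∀ ks {B : Matrix n} → SkewSymmetric B → SkewSymmetric (matrixMutations ks B)
  matrixMutations-skew []       skew = skew
  matrixMutations-skew (k ∷ ks) skew = matrixMutations-skew ks (μ-skew k _ skew)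

  matrixMutations-++ : ∀ ks ls {B : Matrix n} →
    matrixMutations (ks ++ ls) B ≡ matrixMutations ls (matrixMutations ks B)
  matrixMutations-++ ks ls {B} = List.foldl-++ (λ C k → μ k C) B ks ls

  words : ℕ → List (List (Fin n))
  words zero    = [] ∷ []
  words (suc N) = [] ∷ cartesianProductWith _∷_ (allFin n) (words N)

  ∈-words : ∀ {N} ks → length ks ℕ.≤ N → ks ∈ words N
  ∈-words {zero}  []       _         = here refl
  ∈-words {suc N} []       _         = here refl
  ∈-words {suc N} (k ∷ ks) (s≤s len) = there (∈-cartesianProductWith⁺ _∷_ (∈-allFin k) (∈-words ks len))

  module Light {B : Matrix n} (skew : SkewSymmetric B) {M : ℕ} (2≤M : 2 ℕ.≤ M) (b : Bounded M B)
    (light : ∀ ks → length ks ℕ.≤ codes M → ¬ Heavy (matrixMutations ks B)) where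

    private
      bounded : ∀ ks → length ks ℕ.≤ codes M → Bounded M (matrixMutations ks B)
      bounded ks len = bounded-path ks 2≤M skew b λ ks′ len′ → light ks′ (ℕ.≤-trans len′ len)

    -- The word has `codes M` + 1 prefixes, all leading to bounded matrices, so two of these
    -- matrices have the same code. Cutting out the letters between the two prefixes leaves the
    -- final matrix unchanged.
    shorten : ∀ ks → length ks ≡ codes M →
              ∃[ ks′ ] length ks′ ℕ.< codes M × matrixMutations ks′ B ≐ matrixMutations ks B
    shorten ks len
      with i , j , i<j , same ← pigeonhole (ℕ.n<1+n (codes M))
             (λ i → code (matrixMutations (take (toℕ i) ks) B)
               (bounded (take (toℕ i) ks) (ℕ.≤-trans (ℕ.≤-reflexive (List.length-take (toℕ i) ks))
                 (ℕ.≤-trans (ℕ.m⊓n≤n (toℕ i) _) (ℕ.≤-reflexive len))))) =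
      take (toℕ i) ks ++ drop (toℕ j) ks , shorter , λ p q →
        trans (cong (λ C → C p q) (matrixMutations-++ (take (toℕ i) ks) (drop (toℕ j) ks)))
        (trans (matrixMutations-cong (drop (toℕ j) ks) (code-injective _ _ _ _ same) p q)
        (cong (λ C → C p q) (trans (sym (matrixMutations-++ (take (toℕ j) ks) (drop (toℕ j) ks)))
          (cong (λ ls → matrixMutations ls B) (List.take++drop≡id (toℕ j) ks)))))
      where
      open ℕ.≤-Reasoning
      j≤len : toℕ j ℕ.≤ codes M
      j≤len = ℕ.s≤s⁻¹ (Fin.toℕ<n j)
      shorter : length (take (toℕ i) ks ++ drop (toℕ j) ks) ℕ.< codes M
      shorter = begin-strict
        length (take (toℕ i) ks ++ drop (toℕ j) ks)
          ≡⟨ List.length-++ (take (toℕ i) ks) ⟩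
        length (take (toℕ i) ks) ℕ.+ length (drop (toℕ j) ks)
          ≡⟨ cong₂ ℕ._+_ (List.length-take (toℕ i) ks) (List.length-drop (toℕ j) ks) ⟩
        toℕ i ℕ.⊓ length ks ℕ.+ (length ks ℕ.∸ toℕ j)
          ≤⟨ ℕ.+-mono-≤ (ℕ.m⊓n≤m (toℕ i) _) (ℕ.≤-reflexive (cong (ℕ._∸ toℕ j) len)) ⟩
        toℕ i ℕ.+ (codes M ℕ.∸ toℕ j)
          <⟨ ℕ.+-monoˡ-< _ i<j ⟩
        toℕ j ℕ.+ (codes M ℕ.∸ toℕ j)
          ≡⟨ ℕ.m+[n∸m]≡n j≤len ⟩
        codes M ∎

    -- Boundedness is known only for words of length at most `codes M`. So the letters of `ks` are
    -- appended to `ls` one by one, and a word that reaches this length is shortened before the next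
    -- letter.
    shorten-all : ∀ ks ls → length ls ℕ.< codes M →
      ∃[ ks′ ] length ks′ ℕ.< codes M × matrixMutations ks′ B ≐ matrixMutations ks (matrixMutations ls B)
    shorten-all []       ls len = ls , len , λ _ _ → refl
    shorten-all (k ∷ ks) ls len = extend (ℕ.m≤n⇒m<n∨m≡n (ℕ.≤-trans (ℕ.≤-reflexive length-∷ʳ) len))
      where
      length-∷ʳ : length (ls ∷ʳ k) ≡ suc (length ls)
      length-∷ʳ = trans (List.length-++ ls) (ℕ.+-comm (length ls) 1)
      extend : length (ls ∷ʳ k) ℕ.< codes M ⊎ length (ls ∷ʳ k) ≡ codes M → _
      extend (inj₁ short) with ks′ , len′ , eq ← shorten-all ks (ls ∷ʳ k) short =
        ks′ , len′ , λ p q → trans (eq p q)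
          (cong (λ C → matrixMutations ks C p q) (matrixMutations-++ ls (k ∷ [])))
      extend (inj₂ long)
        with ls′ , short , eq′ ← shorten (ls ∷ʳ k) long
        with ks′ , len′ , eq ← shorten-all ks ls′ short =
        ks′ , len′ , λ p q → trans (eq p q) (trans (matrixMutations-cong ks eq′ p q)
          (cong (λ C → matrixMutations ks C p q) (matrixMutations-++ ls (k ∷ []))))

    finite : FiniteSet (MutationClass B)
    finite = List.map (λ ks → matrixMutations ks B) (words (codes M)) , λ C → mk⇔
      (λ { (ks , C≐) →
        -- The shortening starts from the empty word, so `codes M` has to be positive.
        let ks′ , len , eq = shorten-all ks [] (ℕ.m^n>0 _ {{ℕ.m^n≢0 (2 ℕ.* suc M) n}} n)
        in Any.map⁺ (Any.map (λ { refl i j → trans (C≐ i j) (sym (eq i j)) }) (∈-words ks′ (ℕ.<⇒≤ len))) })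
      (λ any → let ks , C≐ = Any.satisfied (Any.map⁻ any) in ks , C≐)

  infinite-reaches-heavy : ∀ {B} → SkewSymmetric B → MutationInfinite B →
    ∃[ ks ] Heavy (matrixMutations ks B)
  infinite-reaches-heavy {B} skew infinite with matrix-bound B
  ... | M , 2≤M , b with heavy-within? (codes M) B
  ...   | yes (ks , _ , heavy) = ks , heavy
  ...   | no light = contradiction
    (Light.finite skew 2≤M b λ ks len heavy → light (ks , len , heavy)) infinite

  infinite-reaches-fork : ∀ {B} → SkewSymmetric B → MutationInfinite B → ReachesFork B
  infinite-reaches-fork skew infinite
    with ks , p , q , r , p≢q , q≢r , r≢p , 3≤ , ≢0 ← infinite-reaches-heavy skew infinite
    with ls , i , j , k , F ← heavy-reaches-fork 3≤ ≢0 (record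
           { skew = matrixMutations-skew ks skew ; p≢q = p≢q ; q≢r = q≢r ; r≢p = r≢p
           ; pq = refl ; qr = refl ; rp = refl }) =
    ks ++ ls , i , j , k , subst (λ C → Fork C i j k) (sym (matrixMutations-++ ks ls)) F

-- The tree of seeds below a fork

open CommutativeRing ℚ.+-*-commutativeRing using (semiring; commutativeSemiring)
open RawSemiringDefs (Semiring.rawSemiring semiring) using (_^_; product)
open Exp semiring using (^-homo-*)
open CommutativeExp commutativeSemiring using (^-distrib-*)
open Exchange ℚ.+-*-commutativeRing using (binomial)

-- Built with `mkℚ`, so that numerator and denominator are visible without normalizing a fraction.
fromℕ : ℕ → ℚ
fromℕ m = mkℚ (+ m) 0 (ℕ.sym (ℕ.1-coprimeTo m))

fromℕ-mono-≤ : ∀ {m n} → m ℕ.≤ n → fromℕ m ℚ.≤ fromℕ n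
fromℕ-mono-≤ m≤n = *≤* (ℤ.*-monoʳ-≤-nonNeg (+ 1) (ℤ.+≤+ m≤n))

fromℕ-mono-< : ∀ {m n} → m ℕ.< n → fromℕ m ℚ.< fromℕ n
fromℕ-mono-< m<n = *<* (ℤ.*-monoʳ-<-pos (+ 1) (ℤ.+<+ m<n))

fromℕ-injective : ∀ {m n} → fromℕ m ≡ fromℕ n → m ≡ n
fromℕ-injective refl = refl

/1≡fromℕ : ∀ m → (+ m) ℚ./ 1 ≡ fromℕ m
/1≡fromℕ m = ℚ.↥p/↧p≡p (fromℕ m)

fromℕ-* : ∀ m n → fromℕ m ℚ.* fromℕ n ≡ fromℕ (m ℕ.* n)
fromℕ-* m n = trans (cong (ℚ._/ 1) (sym (ℤ.pos-* m n))) (/1≡fromℕ (m ℕ.* n))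

fromℕ-^ : ∀ m e → fromℕ m ^ e ≡ fromℕ (m ℕ.^ e)
fromℕ-^ m zero    = refl
fromℕ-^ m (suc e) = trans (cong (fromℕ m ℚ.*_) (fromℕ-^ m e)) (fromℕ-* m (m ℕ.^ e))

0<1 : 0ℚ ℚ.< 1ℚ
0<1 = fromℕ-mono-< (s≤s z≤n)

1≤⇒0< : ∀ {x} → 1ℚ ℚ.≤ x → 0ℚ ℚ.< x
1≤⇒0< = ℚ.<-≤-trans 0<1

1≤⇒≢0 : ∀ {x} → 1ℚ ℚ.≤ x → x ≢ 0ℚ
1≤⇒≢0 1≤x x≡0 = ℚ.<-irrefl (sym x≡0) (1≤⇒0< 1≤x)

*-monoˡ-≤-1≤ : ∀ x {y z} → 1ℚ ℚ.≤ x → y ℚ.≤ z → x ℚ.* y ℚ.≤ x ℚ.* z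
*-monoˡ-≤-1≤ x 1≤x = ℚ.*-monoˡ-≤-nonNeg x {{ℚ.nonNegative (ℚ.<⇒≤ (1≤⇒0< 1≤x))}}

*-monoʳ-≤-1≤ : ∀ x {y z} → 1ℚ ℚ.≤ x → y ℚ.≤ z → y ℚ.* x ℚ.≤ z ℚ.* x
*-monoʳ-≤-1≤ x 1≤x = ℚ.*-monoʳ-≤-nonNeg x {{ℚ.nonNegative (ℚ.<⇒≤ (1≤⇒0< 1≤x))}}

x≤x*y : ∀ {x y} → 1ℚ ℚ.≤ x → 1ℚ ℚ.≤ y → x ℚ.≤ x ℚ.* y
x≤x*y {x} {y} 1≤x 1≤y = subst (ℚ._≤ x ℚ.* y) (ℚ.*-identityʳ x) (*-monoˡ-≤-1≤ x 1≤x 1≤y)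

1≤* : ∀ {x y} → 1ℚ ℚ.≤ x → 1ℚ ℚ.≤ y → 1ℚ ℚ.≤ x ℚ.* y
1≤* 1≤x 1≤y = ℚ.≤-trans 1≤x (x≤x*y 1≤x 1≤y)

1≤^ : ∀ {x} m → 1ℚ ℚ.≤ x → 1ℚ ℚ.≤ x ^ m
1≤^ zero    1≤x = ℚ.≤-refl
1≤^ (suc m) 1≤x = 1≤* 1≤x (1≤^ m 1≤x)

x*x≤x^m : ∀ {x m} → 1ℚ ℚ.≤ x → 2 ℕ.≤ m → x ℚ.* x ℚ.≤ x ^ m
x*x≤x^m {x} {suc (suc m)} 1≤x (s≤s (s≤s _)) = *-monoˡ-≤-1≤ x 1≤x (x≤x*y 1≤x (1≤^ m 1≤x))

1≤product : ∀ {m} {u : Vector ℚ m} → (∀ l → 1ℚ ℚ.≤ u l) → 1ℚ ℚ.≤ product u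
1≤product {zero}  1≤u = ℚ.≤-refl
1≤product {suc m} 1≤u = 1≤* (1≤u zero) (1≤product (1≤u ∘ suc))

factor≤product : ∀ {m} {u : Vector ℚ m} → (∀ l → 1ℚ ℚ.≤ u l) → ∀ l → u l ℚ.≤ product u
factor≤product 1≤u zero = x≤x*y (1≤u zero) (1≤product (1≤u ∘ suc))
factor≤product {u = u} 1≤u (suc l) = ℚ.≤-trans (factor≤product (1≤u ∘ suc) l)
  (subst (ℚ._≤ product u) (ℚ.*-identityˡ _) (*-monoʳ-≤-1≤ _ (1≤product (1≤u ∘ suc)) (1≤u zero)))

module _ {m} {v : Vector ℚ m} (1≤v : ∀ l → 1ℚ ℚ.≤ v l) where

  1≤monomial : ∀ (e : Vector ℕ m) → 1ℚ ℚ.≤ product (λ l → v l ^ e l)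
  1≤monomial e = 1≤product (λ l → 1≤^ (e l) (1≤v l))

  square≤monomial : ∀ (e : Vector ℕ m) l → 2 ℕ.≤ e l → v l ℚ.* v l ℚ.≤ product (λ l → v l ^ e l)
  square≤monomial e l 2≤e =
    ℚ.≤-trans (x*x≤x^m (1≤v l) 2≤e) (factor≤product (λ l → 1≤^ (e l) (1≤v l)) l)

  -- One of the two monomials contains `v l` with exponent at least 2 and otherwise factors ≥ 1; the
  -- other monomial is positive, which makes the inequality strict.
  square<binomial : ∀ (b : Vector ℤ m) {l} → 2 ℕ.≤ ℤ.∣ b l ∣ → v l ℚ.* v l ℚ.< binomial v b
  square<binomial b {l} 2≤∣b∣ = go (b l) refl 2≤∣b∣
    where
    go : ∀ z → b l ≡ z → 2 ℕ.≤ ℤ.∣ z ∣ → v l ℚ.* v l ℚ.< binomial v b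
    go (+ m) bl≡ 2≤m = subst (ℚ._< binomial v b) (ℚ.+-identityʳ (v l ℚ.* v l)) (ℚ.+-mono-≤-<
      (square≤monomial (λ l → [ b l ]₊) l (subst (λ z → 2 ℕ.≤ [ z ]₊) (sym bl≡) 2≤m))
      (1≤⇒0< (1≤monomial (λ l → [ ℤ.- b l ]₊))))
    go -[1+ m ] bl≡ 2≤m = subst (ℚ._< binomial v b) (ℚ.+-identityˡ (v l ℚ.* v l)) (ℚ.+-mono-<-≤
      (1≤⇒0< (1≤monomial (λ l → [ b l ]₊)))
      (square≤monomial (λ l → [ ℤ.- b l ]₊) l (subst (λ z → 2 ℕ.≤ [ ℤ.- z ]₊) (sym bl≡) 2≤m)))

module _ {n : ℕ} (σ : Permutation′ n) where
  open Sum ℚ.*-1-commutativeMonoid using (sum-permute; sum-cong-≗)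

  binomial-relabel : ∀ (v w : Vector ℚ n) (b c : Vector ℤ n) →
    (∀ l → v (σ ⟨$⟩ʳ l) ≡ w l) → (∀ l → b (σ ⟨$⟩ʳ l) ≡ c l) → binomial v b ≡ binomial w c
  binomial-relabel v w b c v≡w b≡c =
    cong₂ ℚ._+_ (monomial (λ z → [ z ]₊)) (monomial (λ z → [ ℤ.- z ]₊))
    where
    monomial : ∀ (e : ℤ → ℕ) → product (λ l → v l ^ e (b l)) ≡ product (λ l → w l ^ e (c l))
    monomial e = trans (sum-permute (λ l → v l ^ e (b l)) σ)
      (sum-cong-≗ (λ l → cong₂ (λ x z → x ^ e z) (v≡w l) (b≡c l)))

  ⟨$⟩ʳ-injective : ∀ {i j} → σ ⟨$⟩ʳ i ≡ σ ⟨$⟩ʳ j → i ≡ j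
  ⟨$⟩ʳ-injective e = trans (sym (inverseˡ σ)) (trans (cong (σ ⟨$⟩ˡ_) e) (inverseˡ σ))

module ℚ-Exchange {n} k (b : Vector ℤ n) (bₖ≡0 : b k ≡ + 0) =
  MutationIndependence ℚ-domain (idHom ℚ.+-*-commutativeRing) k b bₖ≡0

-- An exchange is undone by the same exchange: the old value is the binomial of the new values
-- divided by the new value. So seeds that agree after corresponding exchanges agree before them.
exchange-unique : ∀ {n} (σ : Permutation′ n) {p k b c} → σ ⟨$⟩ʳ k ≡ p →
  (b≡0 : b p ≡ + 0) (c≡0 : c k ≡ + 0) {v v′ w w′ : Vector ℚ n} →
  ℚ-Exchange.Exchanged p b b≡0 v v′ → ℚ-Exchange.Exchanged k c c≡0 w w′ → v′ p ≢ 0ℚ →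
  (∀ l → v′ (σ ⟨$⟩ʳ l) ≡ w′ l) → (∀ l → b (σ ⟨$⟩ʳ l) ≡ c l) → ∀ l → v (σ ⟨$⟩ʳ l) ≡ w l
exchange-unique σ {k = k} {b} {c} refl b≡0 c≡0 {v} {v′} {w} {w′} r s v′≢0 v′≡w′ b≡c l with l ≟ k
... | no l≢k = trans (off-k r (l≢k ∘ ⟨$⟩ʳ-injective σ)) (trans (v′≡w′ l) (sym (off-k s l≢k)))
  where open ℚ-Exchange.Exchanged
... | yes refl = IntegralDomain.*-cancelʳ ℚ-domain _ _ _ v′≢0 (begin
  v (σ ⟨$⟩ʳ k) ℚ.* v′ (σ ⟨$⟩ʳ k)   ≡⟨ ℚ.*-comm (v (σ ⟨$⟩ʳ k)) _ ⟩
  v′ (σ ⟨$⟩ʳ k) ℚ.* v (σ ⟨$⟩ʳ k)   ≡⟨ at-k (ℚ-Exchange.flip _ b b≡0 r) ⟩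
  binomial v′ b                    ≡⟨ binomial-relabel σ v′ w′ b c v′≡w′ b≡c ⟩
  binomial w′ c                    ≡⟨ at-k (ℚ-Exchange.flip _ c c≡0 s) ⟨
  w′ k ℚ.* w k                     ≡⟨ ℚ.*-comm _ (w k) ⟩
  w k ℚ.* w′ k                     ≡⟨ cong (w k ℚ.*_) (v′≡w′ k) ⟨
  w k ℚ.* v′ (σ ⟨$⟩ʳ k)            ∎)
  where
  open ≡.≡-Reasoning
  open ℚ-Exchange.Exchanged

foldl-append : ∀ {A C : Set} (f : A → C → A) x cs ds {u} →
  u ≡ foldl f (foldl f x cs) ds → u ≡ foldl f x (cs ++ ds)
foldl-append f x cs ds eq = trans eq (sym (List.foldl-++ f x cs ds))

foldl-snoc : ∀ {A C : Set} (f : A → C → A) x cs c {u v} →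
  u ≡ f v c → v ≡ foldl f x cs → u ≡ foldl f x (cs ∷ʳ c)
foldl-snoc f x cs c refl refl = sym (List.foldl-∷ʳ f x c cs)

word : ∀ e → Fin (2 ℕ.^ e) → Vec (Fin 2) e
word zero    c = []
word (suc e) c = quotient {2} (2 ℕ.^ e) c ∷ word e (remainder {2} (2 ℕ.^ e) c)

word-injective : ∀ e {c d} → word e c ≡ word e d → c ≡ d
word-injective zero    {zero} {zero} _ = refl
word-injective (suc e) {c} {d} eq = trans (sym (combine-remQuot {2} (2 ℕ.^ e) c))
  (trans (cong₂ combine (Vec.∷-injectiveˡ eq) (word-injective e (Vec.∷-injectiveʳ eq)))
    (combine-remQuot {2} (2 ℕ.^ e) d))

-- Separating the nodes of the tree by their values

module ForkTree {n : ℕ} (T : Seed n) {i₀ j₀ k₀ : Fin n} (F₀ : Fork (Seed.B T) i₀ j₀ k₀) where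
  -- Any injective function with its maximum at k₀ would do.
  rank : Fin n → ℕ
  rank l = if does (l ≟ k₀) then n else toℕ l

  rank-k₀ : rank k₀ ≡ n
  rank-k₀ with k₀ ≟ k₀
  ... | yes _  = refl
  ... | no k≢k = contradiction refl k≢k

  rank<n : ∀ {l} → l ≢ k₀ → rank l ℕ.< n
  rank<n {l} l≢k₀ with l ≟ k₀
  ... | yes l≡k₀ = contradiction l≡k₀ l≢k₀
  ... | no _     = toℕ<n l

  rank-injective : ∀ {l m} → rank l ≡ rank m → l ≡ m
  rank-injective {l} {m} e with l ≟ k₀ | m ≟ k₀
  ... | yes refl | yes refl = refl
  ... | yes _    | no _     = contradiction e (ℕ.<⇒≢ (toℕ<n m) ∘ sym)
  ... | no _     | yes _    = contradiction e (ℕ.<⇒≢ (toℕ<n l))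
  ... | no _     | no _     = toℕ-injective e

  -- The successor keeps every value at least 1, also at a vertex of rank 0.
  z : Vector ℚ n
  z l = fromℕ (suc (rank l))

  open Specialization ℚ⟨x n ⟩ (constᶠHom n) (Seed.f T) z

  -- A node of the tree. The point of return `k` of its fork, which below the root is the vertex
  -- mutated last, is also the unique place of the largest value.
  record State : Set where
    no-eta-equality
    field
      seed    : Seed n
      {i j k} : Fin n
    open Seed seed public
    field
      isFork : Fork B i j k
      v      : Vector ℚ n
      values : ∀ l → HasValue (f l) (v l)
      1≤v    : ∀ l → 1ℚ ℚ.≤ v l
      v<vₖ   : ∀ {l} → l ≢ k → v l ℚ.< v k

  root : State
  root = record
    { seed = T ; isFork = F₀ ; v = z
    ; values = variable-value
    ; 1≤v = λ l → fromℕ-mono-≤ (s≤s z≤n)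
    ; v<vₖ = λ {l} l≢k₀ → fromℕ-mono-< (s≤s (subst (rank l ℕ.<_) (sym rank-k₀) (rank<n l≢k₀)))
    }

  module _ (s : State) where
    open State s

    -- What the two children of a node have in common. The weight ≥ 2 between `p` and `k` brings the
    -- square of `v k` into the binomial, and `p` becomes the next point of return.
    record Direction : Set where
      field
        {p i′ j′} : Fin n
        p≢k       : p ≢ k
        2≤∣Bₚₖ∣   : 2 ℕ.≤ ℤ.∣ B p k ∣
        isFork′   : Fork (μ p B) i′ j′ p

    module Step (direction : Direction) where
      open Direction direction
      open ℚ-Exchange p (B p) (skew-diagonal skew p) using (Exchanged; module Exchanged)

      private instance
        vₚ-nonZero : ℚ.NonZero (v p)
        vₚ-nonZero = ℚ.≢-nonZero (1≤⇒≢0 (1≤v p))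

      v′ : Vector ℚ n
      v′ = updateAt v p (λ _ → ℚ.1/ v p ℚ.* binomial v (B p))

      exchanged : Exchanged v v′
      exchanged = record
        { at-k = trans (cong (v p ℚ.*_) (updateAt-updates p v))
            (trans (sym (ℚ.*-assoc (v p) _ _)) (trans (cong (ℚ._* binomial v (B p)) (ℚ.*-inverseʳ (v p)))
              (ℚ.*-identityˡ _)))
        ; off-k = λ {l} l≢p → sym (updateAt-minimal l p v l≢p) }

      open Exchanged exchanged

      v≤vₖ : ∀ l → v l ℚ.≤ v k
      v≤vₖ l with l ≟ k
      ... | yes refl = ℚ.≤-refl
      ... | no l≢k   = ℚ.<⇒≤ (v<vₖ l≢k)

      -- Cancel `v p` in v p · v k ≤ v k · v k < binomial = v p · v′ p.
      vₖ<v′ₚ : v k ℚ.< v′ p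
      vₖ<v′ₚ = ℚ.*-cancelˡ-<-nonNeg (v p) {{ℚ.nonNegative (ℚ.<⇒≤ (1≤⇒0< (1≤v p)))}}
        (subst (v p ℚ.* v k ℚ.<_) (sym at-k)
          (ℚ.≤-<-trans (*-monoʳ-≤-1≤ (v k) (1≤v k) (v≤vₖ p)) (square<binomial 1≤v (B p) 2≤∣Bₚₖ∣)))

      v′<v′ₚ : ∀ {l} → l ≢ p → v′ l ℚ.< v′ p
      v′<v′ₚ {l} l≢p = subst (ℚ._< v′ p) (off-k l≢p) (ℚ.≤-<-trans (v≤vₖ l) vₖ<v′ₚ)

      1≤v′ : ∀ l → 1ℚ ℚ.≤ v′ l
      1≤v′ l with l ≟ p
      ... | yes refl = ℚ.≤-trans (1≤v k) (ℚ.<⇒≤ vₖ<v′ₚ)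
      ... | no l≢p   = subst (1ℚ ℚ.≤_) (off-k l≢p) (1≤v l)

      values′ : ∀ l → HasValue (Seed.f (mutate p seed) l) (v′ l)
      values′ = exchange-value (mutation-exchanges p B skew f fₚ≉0) exchanged (1≤⇒≢0 (1≤v p)) values
        where
        fₚ≉0 = MutationIndependence.independent⇒≉0 ℚ⟨x n ⟩ (constᶠHom n) p (B p)
                 (skew-diagonal skew p) independent

      next : State
      next = record
        { seed = mutate p seed ; isFork = isFork′ ; v = v′
        ; values = values′ ; 1≤v = 1≤v′ ; v<vₖ = v′<v′ₚ }

    private module F = Fork isFork

    direction : Fin 2 → Direction
    direction zero = record
      { p≢k = F.k≢i ∘ sym
      ; 2≤∣Bₚₖ∣ = subst (2 ℕ.≤_)
          (sym (trans (cong ℤ.∣_∣ (trans (skew i k) (cong ℤ.-_ F.ki))) (ℤ.∣-i∣≡∣i∣ (+ F.c)))) F.2≤c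
      ; isFork′ = fork-mutateˡ isFork }
    direction (suc zero) = record
      { p≢k = F.j≢k
      ; 2≤∣Bₚₖ∣ = subst (2 ℕ.≤_) (sym (cong ℤ.∣_∣ F.jk)) F.2≤b
      ; isFork′ = fork-mutateʳ isFork }

  branch : Fin 2 → State → State
  branch a s = Step.next s (direction s a)

  branch-mutates : ∀ a s → ∃[ p ] State.seed (branch a s) ≡ mutate p (State.seed s)
  branch-mutates a s = _ , refl

  -- The head of a word is its last mutation, so induction on the word first undoes the mutation
  -- that `k` records.
  tree : ∀ {e} → Vec (Fin 2) e → State
  tree []      = root
  tree (a ∷ w) = branch a (tree w)

  -- What `≈ˢ` leaves after specialization: numbers take the place of rational functions.
  record Match (σ : Permutation′ n) (s t : State) : Set where
    private
      module s = State s
      module t = State t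
    field
      v-match : ∀ l → s.v (σ ⟨$⟩ʳ l) ≡ t.v l
      B-match : ∀ l m → s.B (σ ⟨$⟩ʳ l) (σ ⟨$⟩ʳ m) ≡ t.B l m

    -- If σ sent `t.k` elsewhere, its image would have a value below the maximum of `s.v`. But that
    -- maximum is also a value of `t`, hence at most `t.v t.k`, the value of this very image.
    k-match : σ ⟨$⟩ʳ t.k ≡ s.k
    k-match with σ ⟨$⟩ʳ t.k ≟ s.k
    ... | yes e = e
    ... | no ≢k = contradiction (ℚ.<-≤-trans (s.v<vₖ ≢k) (begin
      s.v s.k                       ≡⟨ cong s.v (inverseʳ σ) ⟨
      s.v (σ ⟨$⟩ʳ (σ ⟨$⟩ˡ s.k))     ≡⟨ v-match _ ⟩
      t.v (σ ⟨$⟩ˡ s.k)              ≤⟨ t≤tₖ _ ⟩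
      t.v t.k                       ≡⟨ v-match t.k ⟨
      s.v (σ ⟨$⟩ʳ t.k)              ∎)) (ℚ.<-irrefl refl)
      where
      open ℚ.≤-Reasoning
      t≤tₖ : ∀ l → t.v l ℚ.≤ t.v t.k
      t≤tₖ l with l ≟ t.k
      ... | yes refl = ℚ.≤-refl
      ... | no l≢k   = ℚ.<⇒≤ (t.v<vₖ l≢k)
  open Match

  ≈ˢ⇒Match : ∀ s t → State.seed s ≈ˢ State.seed t → ∃[ σ ] Match σ s t
  ≈ˢ⇒Match s t (σ , f≈ , B≡) = σ , record
    { v-match = λ l →
        value-unique (Seed.independent T) (f≈ l) (State.values s (σ ⟨$⟩ʳ l)) (State.values t l)
    ; B-match = B≡ }

  module _ (σ : Permutation′ n) where

    -- By `k-match`, σ carries the vertex mutated last in one seed to that of the other. Mutating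
    -- back there recovers both matrices, and `exchange-unique` then recovers the values.
    branch-match : ∀ a b s t → Match σ (branch a s) (branch b t) → Match σ s t
    branch-match a b s t match = record
      { v-match = exchange-unique σ (k-match match) (skew-diagonal s.skew p) (skew-diagonal t.skew p′)
          (Step.exchanged s (direction s a)) (Step.exchanged t (direction t b))
          (1≤⇒≢0 (Step.1≤v′ s (direction s a) p)) (v-match match)
          (λ l → trans (cong (λ q → s.B q (σ ⟨$⟩ʳ l)) (sym (k-match match))) (B-before p′ l))
      ; B-match = B-before }
      where
      module s = State s
      module t = State t
      open ≡.≡-Reasoning
      p p′ : Fin n
      p  = Direction.p (direction s a)
      p′ = Direction.p (direction t b)
      B-before : ∀ l m → s.B (σ ⟨$⟩ʳ l) (σ ⟨$⟩ʳ m) ≡ t.B l m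
      B-before l m = begin
        s.B (σ ⟨$⟩ʳ l) (σ ⟨$⟩ʳ m)
          ≡⟨ μ-involutive p s.B _ _ ⟨
        μ p (μ p s.B) (σ ⟨$⟩ʳ l) (σ ⟨$⟩ʳ m)
          ≡⟨ cong (λ q → μ q (μ p s.B) (σ ⟨$⟩ʳ l) (σ ⟨$⟩ʳ m)) (k-match match) ⟨
        μ (σ ⟨$⟩ʳ p′) (μ p s.B) (σ ⟨$⟩ʳ l) (σ ⟨$⟩ʳ m)
          ≡⟨ μ-relabel (σ ⟨$⟩ʳ_) (⟨$⟩ʳ-injective σ) p′ (μ p s.B) l m ⟩
        μ p′ (λ l m → μ p s.B (σ ⟨$⟩ʳ l) (σ ⟨$⟩ʳ m)) l m
          ≡⟨ μ-cong p′ (B-match match) l m ⟩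
        μ p′ (μ p′ t.B) l m
          ≡⟨ μ-involutive p′ t.B l m ⟩
        t.B l m ∎

    -- The points of return of the two children are the distinct vertices `i` and `j` of the fork of
    -- `s`, and a match along the identity would equate them.
    same-branch : (∀ l → σ ⟨$⟩ʳ l ≡ l) → ∀ a b s → Match σ (branch a s) (branch b s) → a ≡ b
    same-branch σ≡id zero       zero       s match = refl
    same-branch σ≡id (suc zero) (suc zero) s match = refl
    same-branch σ≡id zero       (suc zero) s match =
      contradiction (trans (sym (k-match match)) (σ≡id _)) (Fork.i≢j (State.isFork s))
    same-branch σ≡id (suc zero) zero       s match =
      contradiction (trans (sym (σ≡id _)) (k-match match)) (Fork.i≢j (State.isFork s))

    root-match : Match σ root root → ∀ l → σ ⟨$⟩ʳ l ≡ l
    root-match match l = rank-injective (ℕ.suc-injective (fromℕ-injective (v-match match l)))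

    -- The same σ matches all pairs of ancestors up to the root, where it is seen to be the
    -- identity; with this knowledge the letters are compared on the way back.
    match⇒same : ∀ {e} (w w′ : Vec (Fin 2) e) → Match σ (tree w) (tree w′) →
                 w ≡ w′ × (∀ l → σ ⟨$⟩ʳ l ≡ l)
    match⇒same []      []        match = refl , root-match match
    match⇒same (a ∷ w) (b ∷ w′) match
      with match⇒same w w′ (branch-match a b (tree w) (tree w′) match)
    ... | refl , σ≡id = cong (_∷ w) (same-branch σ≡id a b (tree w) match) , σ≡id

  matching-words : ∀ {e} (w w′ : Vec (Fin 2) e) → ∃[ σ ] Match σ (tree w) (tree w′) → w ≡ w′
  matching-words w w′ (σ , match) = proj₁ (match⇒same σ w w′ match)

  distinct : ∀ {e} (w w′ : Vec (Fin 2) e) → w ≢ w′ → ¬ (State.seed (tree w) ≈ˢ State.seed (tree w′))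
  distinct w w′ w≢w′ S≈T = w≢w′ (matching-words w w′ (≈ˢ⇒Match (tree w) (tree w′) S≈T))

  within-step : ∀ {e} S U → ∃[ p ] U ≡ mutate p S →
    WithinMutations e T S → WithinMutations (suc e) T U
  within-step S U (p , eq) (ps , len , eq′) =
    ps ∷ʳ p ,
    ℕ.≤-trans (ℕ.≤-reflexive (trans (List.length-++ ps) (ℕ.+-comm (length ps) 1))) (s≤s len) ,
    foldl-snoc (λ T k → mutate k T) T ps p {U} {S} eq eq′

  tree-within : ∀ {e} (w : Vec (Fin 2) e) → WithinMutations e T (State.seed (tree w))
  tree-within []      = [] , z≤n , refl
  tree-within (a ∷ w) = within-step (State.seed (tree w)) (State.seed (branch a (tree w)))
    (branch-mutates a (tree w)) (tree-within w)

-- Counting seeds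

mutations-B : ∀ {n} ks (S : Seed n) → Seed.B (mutations ks S) ≡ matrixMutations ks (Seed.B S)
mutations-B []       S = refl
mutations-B (k ∷ ks) S = mutations-B ks (mutate k S)

within-++ : ∀ {n} ks {e} {S U : Seed n} → WithinMutations e (mutations ks S) U →
            WithinMutations (length ks ℕ.+ e) S U
within-++ ks {S = S} (ls , len , eq) =
  ks ++ ls ,
  ℕ.≤-trans (ℕ.≤-reflexive (List.length-++ ks)) (ℕ.+-monoʳ-≤ (length ks) len) ,
  foldl-append (λ T k → mutate k T) S ks ls eq

-- The product `ℚ.½ ℚ.* fromℕ 2` computes to `1ℚ`, so this is a power of 1.
½^*2^≡1 : ∀ d → ℚ.½ ^ d ℚ.* fromℕ 2 ^ d ≡ 1ℚ
½^*2^≡1 d = trans (sym (^-distrib-* ℚ.½ (fromℕ 2) d)) (Ones.1^ 0 d)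

0<½^ : ∀ d → 0ℚ ℚ.< ℚ.½ ^ d
0<½^ zero    = 0<1
0<½^ (suc d) = ℚ.positive⁻¹ _ {{ℚ.pos*pos⇒pos ℚ.½ (ℚ.½ ^ d) {{ℚ.positive (0<½^ d)}}}}

½^≤1 : ∀ d → ℚ.½ ^ d ℚ.≤ 1ℚ
½^≤1 zero    = ℚ.≤-refl
½^≤1 (suc d) = ℚ.≤-trans (ℚ.*-monoˡ-≤-nonNeg ℚ.½ (½^≤1 d)) (ℚ.*≤* (ℤ.+≤+ (s≤s z≤n)))

module Growth {n : ℕ} {B : Matrix n} (skew : SkewSymmetric B) (ks : List (Fin n)) {i j k : Fin n}
              (F : Fork (matrixMutations ks B) i j k) where

  private
    d = length ks
    S = initialSeed B skew

  open ForkTree (mutations ks S) (subst (λ C → Fork C i j k) (sym (mutations-B ks S)) F)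

  DistinctSeeds : ℕ → Set
  DistinctSeeds m = Σ[ Ss ∈ List (Seed n) ]
    All (WithinMutations m S) Ss × AllPairs (λ S T → ¬ (S ≈ˢ T)) Ss ×
    ℚ.½ ^ d ℚ.* fromℕ 2 ^ m ℚ.≤ (+ length Ss) ℚ./ 1

  leaf : ∀ e → Fin (2 ℕ.^ e) → Seed n
  leaf e c = State.seed (tree (word e c))

  -- The factor ½^d pays for the `d` mutations that lead to the fork: ½^d · 2^(d + e) = 2^e is the
  -- number of leaves at depth `e`.
  leaves : ∀ e → DistinctSeeds (d ℕ.+ e)
  leaves e =
    tabulate (leaf e) ,
    All.tabulate⁺ (λ c → within-++ ks {S = S} {leaf e c} (tree-within (word e c))) ,
    AllPairs.tabulate⁺ {R = λ S T → ¬ (S ≈ˢ T)} {f = leaf e}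
      (λ {c} {d} c≢d → distinct (word e c) (word e d) (c≢d ∘ word-injective e)) ,
    ℚ.≤-reflexive (begin
      ℚ.½ ^ d ℚ.* fromℕ 2 ^ (d ℕ.+ e)              ≡⟨ cong (ℚ.½ ^ d ℚ.*_) (^-homo-* (fromℕ 2) d e) ⟩
      ℚ.½ ^ d ℚ.* (fromℕ 2 ^ d ℚ.* fromℕ 2 ^ e)    ≡⟨ ℚ.*-assoc (ℚ.½ ^ d) _ _ ⟨
      ℚ.½ ^ d ℚ.* fromℕ 2 ^ d ℚ.* fromℕ 2 ^ e      ≡⟨ cong (ℚ._* fromℕ 2 ^ e) (½^*2^≡1 d) ⟩
      1ℚ ℚ.* fromℕ 2 ^ e                           ≡⟨ ℚ.*-identityˡ _ ⟩
      fromℕ 2 ^ e                                  ≡⟨ fromℕ-^ 2 e ⟩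
      fromℕ (2 ℕ.^ e)                              ≡⟨ /1≡fromℕ (2 ℕ.^ e) ⟨
      (+ (2 ℕ.^ e)) ℚ./ 1
        ≡⟨ cong (λ l → (+ l) ℚ./ 1) (List.length-tabulate (leaf e)) ⟨
      (+ length (tabulate (leaf e))) ℚ./ 1         ∎)
    where open ≡.≡-Reasoning

  -- Before the fork is reached one seed is enough, as ½^d · 2^m = ½^(d - m) ≤ 1.
  initial : ∀ m e → m ℕ.+ e ≡ d → DistinctSeeds m
  initial m e m+e≡d =
    S ∷ [] , ([] , z≤n , refl) ∷ [] , [] ∷ [] ,
    ℚ.≤-trans (ℚ.≤-reflexive (begin
      ℚ.½ ^ d ℚ.* fromℕ 2 ^ m
        ≡⟨ cong (λ d → ℚ.½ ^ d ℚ.* fromℕ 2 ^ m) (trans (sym m+e≡d) (ℕ.+-comm m e)) ⟩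
      ℚ.½ ^ (e ℕ.+ m) ℚ.* fromℕ 2 ^ m              ≡⟨ cong (ℚ._* fromℕ 2 ^ m) (^-homo-* ℚ.½ e m) ⟩
      ℚ.½ ^ e ℚ.* ℚ.½ ^ m ℚ.* fromℕ 2 ^ m          ≡⟨ ℚ.*-assoc (ℚ.½ ^ e) _ _ ⟩
      ℚ.½ ^ e ℚ.* (ℚ.½ ^ m ℚ.* fromℕ 2 ^ m)        ≡⟨ cong (ℚ.½ ^ e ℚ.*_) (½^*2^≡1 m) ⟩
      ℚ.½ ^ e ℚ.* 1ℚ                               ≡⟨ ℚ.*-identityʳ _ ⟩
      ℚ.½ ^ e                                      ∎))
    (½^≤1 e)
    where open ≡.≡-Reasoning

  distinctSeeds : ∀ m → d ℕ.≤ m ⊎ m ℕ.< d → DistinctSeeds m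
  distinctSeeds m (inj₁ d≤m) = subst DistinctSeeds (ℕ.m+[n∸m]≡n d≤m) (leaves (m ℕ.∸ d))
  distinctSeeds m (inj₂ m<d) = initial m (d ℕ.∸ m) (ℕ.m+[n∸m]≡n (ℕ.<⇒≤ m<d))

  exponentialGrowth : ExponentialGrowth (𝔄 B skew)
  exponentialGrowth = ℚ.½ ^ d , fromℕ 2 , 0<½^ d , fromℕ-mono-< (s≤s (s≤s z≤n)) ,
    λ m → distinctSeeds m (ℕ.≤-<-connex d m)

fork-growth : ∀ {n} {B : Matrix n} (skew : SkewSymmetric B) → ReachesFork B → ExponentialGrowth (𝔄 B skew)
fork-growth skew (ks , _ , _ , _ , F) = Growth.exponentialGrowth skew ks F

theorem8p2 : ∀ (n : ℕ) (B : Matrix n) (skew : SkewSymmetric B) →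
    MutationInfinite B → ExponentialGrowth (𝔄 B skew)
theorem8p2 n B skew infinite = fork-growth skew (infinite-reaches-fork skew infinite)
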